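{- Coverability, termination and boundedness are decidable for nets with nested coloured tokens (NNCT). That is, each of the following problems is decidable: (a) given an NNCT $\mathcal N$ and configurations $s_0,s_{\mathrm{cov}}\in\mathit{Config}$, is there $s'$ with $s_0\to_{\mathcal N}^* s'$ and $s_{\mathrm{cov}}\le_{\mathit{Config}} s'$? (b) given $\mathcal N$ and $s_0\in\mathit{Config}$, is there an infinite $\to_{\mathcal N}$-path from $s_0$? (c) given $\mathcal N$ and $s_0\in\mathit{Config}$, is $\{s : s_0\to_{\mathcal N}^* s\}$ finite?
   Context: Multisets. $\mathbb M[U]$ is the set of finite multisets over $U$; $\oplus,\ominus$ are multiset union and difference ($M_1=M\ominus M_2$ if $M=M_1\oplus M_2$), extended pointwise to multiset-valued functions; $M\restriction U_0$ (and $m\restriction P$ for a multiset-valued map $m$) is restriction, with the empty multiset outside the restricted set. $\vec 0$ is the map with all values $\emptyset$, and $\{p\mapsto M\}$ is the map sending $p$ to $M$ and everything else to $\emptyset$. $\mathbb M[\{\bullet\}]$ is the set of multisets over one symbol; $|\cdot|$ is multiset size. For a preorder $\le_U$, $M_1\le_{\mathbb M[U]}M_2$ means there is an injection from the elements (with multiplicity) of $M_1$ to those of $M_2$ mapping each $u$ to some $u'$ with $u\le_U u'$. NNCT. An NNCT is $\mathcal N=(P^S,P^C,P^I,\mathcal R,\zeta)$ with finite sets of simple places $P^S$, complex places $P^C$, colours $P^I$, rules $\mathcal R$, and a map $\zeta:P^I\to P^S$. A complex token is a map $m:P^I\to\mathbb M[\{\bullet\}]$; let $\mathbb M^I$ be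 the set of complex tokens. A configuration $s\in\mathit{Config}$ assigns to each $p\in P^S$ an element of $\mathbb M[\{\bullet\}]$ and to each $p\in P^C$ an element of $\mathbb M[\mathbb M^I]$. $\mathit{Config}_S$ is the set of configurations with all complex places empty. Rules are partitioned into simple, complex and transfer rules: (1) a simple rule is $(I,O)$ with $I,O\in\mathit{Config}$ and $I(p)(m)=0$ whenever $p\in P^C$ and $m\ne\vec 0$; if $s=s_0\oplus I$ then $s\to_{\mathcal N}s_0\oplus O$; (2) a complex rule is $((p,I),(p',\mathfrak c,O))$ with $p,p'\in P^C$, $I,O\in\mathit{Config}_S$, $\mathfrak c\in\mathbb M^I$; if $s=s_0\oplus I\oplus\{p\mapsto[m]\}$ then $s\to_{\mathcal N}s_0\oplus O\oplus\{p'\mapsto[m\oplus\mathfrak c]\}$; (3) a transfer rule is $((p,I),(p',P,O))$ with $p,p'\in P^C$, $I,O\in\mathit{Config}_S$, $P\subseteq P^I$ with $\zeta$ injective on $P$; if $s=s_0\oplus I\oplus\{p\mapsto[m]\}$ then $s\to_{\mathcal N}s_0\oplus O\oplus(m_P\circ\zeta^{ -1})\oplus\{p'\mapsto[m\restriction(P^I\setminus P)]\}$, where $m_P\circ\zeta^{ -1}$ sends $\zeta(c)$ to $m(c)$ for $c\in P$ and everything else to $\emptyset$. Here $s_0\in\mathit{Config}$ and $[m]$ is the singleton multiset. $\to^*_{\mathcal N}$ is the reflexive-transitive closure of $\to_{\mathcal N}$. Orders. For $m,m'\in\mathbb M^I$: $m\le_I m'$ iff for every colour $c$ either $0=|m(c)|=|m'(c)|$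 or $0<|m(c)|\le|m'(c)|$. For configurations: $s\le_{\mathit{Config}}s'$ iff $|s(p)|\le|s'(p)|$ for all $p\in P^S$ and $s(p)\le_{\mathbb M[\mathbb M^I]}s'(p)$ (multiset extension of $\le_I$) for all $p\in P^C$. -}

module Defs where

open import Data.Bool using (if_then_else_)
open import Data.Fin using (Fin)
open import Data.Fin.Properties using (any?; _≟_)
open import Data.Fin.Subset using (Subset; ∁; _∈_)
open import Data.Fin.Subset.Properties using (_∈?_)
open import Data.List as List using (List; []; [_]; _++_; length)
open import Data.List.Membership.Propositional using () renaming (_∉_ to _∉ˡ_)
open import Data.List.Relation.Binary.Permutation.Propositional using (_↭_)
open import Data.List.Relation.Unary.Any using (Any)
open import Data.Nat using (ℕ; zero; suc; _+_; _≤_; _<_)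
open import Data.Product using (Σ; ∃-syntax; _×_; _,_)
open import Data.Sum using (_⊎_)
open import Data.Vec using (Vec; lookup; replicate; tabulate; zipWith; _[_]≔_)
open import Data.Vec.Relation.Binary.Pointwise.Inductive using (Pointwise)
open import Function.Bundles using (_↣_; _⇔_; Injection)
open import Relation.Binary.Construct.Closure.ReflexiveTransitive using (Star)
open import Relation.Binary.PropositionalEquality using (_≡_; _≢_)
open import Relation.Nullary using (yes; no)
open import Relation.Nullary.Decidable using (_×-dec_)

-- Finite sets of places and colours are Fin n, and maps out of them are vectors.
-- A multiset over the single symbol • is its size, a natural number.
-- A multiset of complex tokens is a list up to permutation (_↭_).

variable
  nˢ nᶜ nⁱ : ℕ

Token : ℕ → Set
Token nⁱ = Vec ℕ nⁱ

𝟎 : ∀ {n} → Vec ℕ n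
𝟎 = replicate _ 0

_⊕ₜ_ : ∀ {n} → Vec ℕ n → Vec ℕ n → Vec ℕ n
_⊕ₜ_ = zipWith _+_

_↾_ : Token nⁱ → Subset nⁱ → Token nⁱ
m ↾ P = zipWith (λ k c∈P → if c∈P then k else 0) m P

InjectiveOn : (Fin nⁱ → Fin nˢ) → Subset nⁱ → Set
InjectiveOn ζ P = ∀ {c c′} → c ∈ P → c′ ∈ P → ζ c ≡ ζ c′ → c ≡ c′

-- m_P ∘ ζ⁻¹.  When ζ is injective on P the colour found by any? is the only
-- one in P that ζ sends to p.
ejectAt : (Fin nⁱ → Fin nˢ) → Subset nⁱ → Token nⁱ → Fin nˢ → ℕ
ejectAt ζ P m p with any? (λ c → (c ∈? P) ×-dec (ζ c ≟ p))
... | yes (c , _) = lookup m c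
... | no _        = 0

eject : (Fin nⁱ → Fin nˢ) → Subset nⁱ → Token nⁱ → Vec ℕ nˢ
eject ζ P m = tabulate (ejectAt ζ P m)

record Config (nˢ nᶜ nⁱ : ℕ) : Set where
  constructor config
  field
    simple  : Vec ℕ nˢ
    complex : Vec (List (Token nⁱ)) nᶜ

open Config public

infix 4 _≈_

_≈_ : Config nˢ nᶜ nⁱ → Config nˢ nᶜ nⁱ → Set
s ≈ s′ = simple s ≡ simple s′ × Pointwise _↭_ (complex s) (complex s′)

infixl 6 _⊕_

_⊕_ : Config nˢ nᶜ nⁱ → Config nˢ nᶜ nⁱ → Config nˢ nᶜ nⁱ
s ⊕ s′ = config (simple s ⊕ₜ simple s′) (zipWith _++_ (complex s) (complex s′))

onlySimple : Vec ℕ nˢ → Config nˢ nᶜ nⁱ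
onlySimple v = config v (replicate _ [])

⟦_↦_⟧ : Fin nᶜ → Token nⁱ → Config nˢ nᶜ nⁱ
⟦ p ↦ m ⟧ = config 𝟎 (replicate _ [] [ p ]≔ [ m ])

InConfigₛ : Config nˢ nᶜ nⁱ → Set
InConfigₛ s = ∀ p → lookup (complex s) p ≡ []

infix 4 _≤ᴵ_ _≤ᶜ_

_≤ᴵ_ : Token nⁱ → Token nⁱ → Set
m ≤ᴵ m′ = ∀ c → (0 ≡ lookup m c × lookup m c ≡ lookup m′ c)
              ⊎ (0 < lookup m c × lookup m c ≤ lookup m′ c)

-- Positions in a list are the elements of the multiset, with multiplicity.
MultisetExt : {U : Set} → (U → U → Set) → List U → List U → Set
MultisetExt _≤ᵁ_ M₁ M₂ =
  Σ (Fin (length M₁) ↣ Fin (length M₂)) λ f →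
    ∀ i → List.lookup M₁ i ≤ᵁ List.lookup M₂ (Injection.to f i)

_≤ᶜ_ : Config nˢ nᶜ nⁱ → Config nˢ nᶜ nⁱ → Set
s ≤ᶜ s′ = (∀ p → lookup (simple s) p ≤ lookup (simple s′) p)
        × (∀ p → MultisetExt _≤ᴵ_ (lookup (complex s) p) (lookup (complex s′) p))

data Rule (nˢ nᶜ nⁱ : ℕ) (ζ : Fin nⁱ → Fin nˢ) : Set where
  simpleRule :
    (I O : Config nˢ nᶜ nⁱ) →
    (∀ p m → m ≢ 𝟎 → m ∉ˡ lookup (complex I) p) →
    Rule nˢ nᶜ nⁱ ζ
  complexRule :
    (p : Fin nᶜ) (I : Config nˢ nᶜ nⁱ)
    (p′ : Fin nᶜ) (𝔠 : Token nⁱ) (O : Config nˢ nᶜ nⁱ) →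
    InConfigₛ I → InConfigₛ O →
    Rule nˢ nᶜ nⁱ ζ
  transferRule :
    (p : Fin nᶜ) (I : Config nˢ nᶜ nⁱ)
    (p′ : Fin nᶜ) (P : Subset nⁱ) (O : Config nˢ nᶜ nⁱ) →
    InConfigₛ I → InConfigₛ O → InjectiveOn ζ P →
    Rule nˢ nᶜ nⁱ ζ

Fires : {ζ : Fin nⁱ → Fin nˢ} → Rule nˢ nᶜ nⁱ ζ →
        Config nˢ nᶜ nⁱ → Config nˢ nᶜ nⁱ → Set
Fires (simpleRule I O _) s t =
  ∃[ s₀ ] s ≈ s₀ ⊕ I × t ≈ s₀ ⊕ O
Fires (complexRule p I p′ 𝔠 O _ _) s t =
  ∃[ s₀ ] ∃[ m ] s ≈ s₀ ⊕ I ⊕ ⟦ p ↦ m ⟧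
               × t ≈ s₀ ⊕ O ⊕ ⟦ p′ ↦ m ⊕ₜ 𝔠 ⟧
Fires {ζ = ζ} (transferRule p I p′ P O _ _ _) s t =
  ∃[ s₀ ] ∃[ m ] s ≈ s₀ ⊕ I ⊕ ⟦ p ↦ m ⟧
               × t ≈ s₀ ⊕ O ⊕ onlySimple (eject ζ P m) ⊕ ⟦ p′ ↦ m ↾ ∁ P ⟧

record NNCT : Set where
  field
    #simple #complex #colours : ℕ
    ζ     : Fin #colours → Fin #simple
    rules : List (Rule #simple #complex #colours ζ)

  Conf : Set
  Conf = Config #simple #complex #colours

  infix 4 _⟶_ _⟶*_

  _⟶_ : Conf → Conf → Set
  s ⟶ t = Any (λ r → Fires r s t) rules

  -- Star alone is reflexive only up to _≡_; configurations are equal up to _≈_.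
  _⟶*_ : Conf → Conf → Set
  s ⟶* t = ∃[ t′ ] Star _⟶_ s t′ × t′ ≈ t

  Coverable : Conf → Conf → Set
  Coverable s₀ s-cov = ∃[ s′ ] s₀ ⟶* s′ × s-cov ≤ᶜ s′

  HasInfinitePath : Conf → Set
  HasInfinitePath s₀ =
    Σ (ℕ → Conf) λ s → s zero ≈ s₀ × (∀ n → s n ⟶ s (suc n))

  FinitelyReachable : Conf → Set
  FinitelyReachable s₀ =
    Σ (List Conf) λ ss → ∀ s → (s₀ ⟶* s) ⇔ Any (s ≈_) ss

{-# OPTIONS --safe #-}
module Submission where

-- NNCTs are well-structured: ≤ᶜ is a well-quasi-order along which firings can be imitated.
-- Constructively, "well-quasi-order" is the inductive notion of an almost-full relation, which is
-- closed under products (Ramsey) and under multiset embedding (Higman).  Hence any search that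
-- only ever visits configurations not above an earlier one terminates:
--   * following all firings until a configuration s is above an ancestor a decides termination,
--     since the path from a to s can then be repeated forever;
--   * the same search decides boundedness: if a ≼ s, then either a ≈ s and the branch may be cut,
--     or s is heavier, and repeating the path produces ever heavier configurations;
--   * saturating a finite basis of configurations under small predecessors decides coverability.
-- The weight of a configuration (all its tokens, including those nested in complex tokens) bounds
-- the instances of a rule that must be tried: a firing from s uses no instance heavier than s, and
-- to cover t after a firing one may drop every bystander not matched with a token of t and
-- truncate the multiplicities of the transformed token just above the weight of t.

open import Defs hiding (_≈_)
import Defs
open import Algebra.Properties.CommutativeSemigroup using (interchange; x∙yz≈y∙xz)
open import Data.Bool using (true; false; if_then_else_)
open import Data.Empty using (⊥; ⊥-elim)
open import Data.Fin as Fin using (Fin; zero; suc)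
import Data.Fin.Properties as Fin
open import Data.Fin.Subset as Subset using (Subset; ∁)
import Data.Fin.Subset.Properties as Subset
open import Data.List as List
  using (List; []; [_]; _∷_; _++_; length; removeAt; upTo; cartesianProductWith;
         cartesianProduct; concatMap; map; filter)
open import Data.List.Properties using (++-assoc; ++-identityʳ; map-++; map-tabulate; tabulate-lookup)
open import Data.List.Membership.Propositional as ∈ using (_∈_)
open import Data.List.Membership.Propositional.Properties
  using (∈-∃++; ∈-++⁻; ∈-cartesianProductWith⁺; ∈-cartesianProduct⁺; ∈-upTo⁺; ∈-allFin;
         ∈-map⁺; ∈-map⁻; ∈-filter⁺; ∈-filter⁻)
import Data.List.Relation.Binary.Permutation.Homogeneous as Homogeneous
open import Data.List.Relation.Binary.Permutation.Propositional as Perm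
  using (_↭_; prep; swap; ↭-refl; ↭-sym; ↭-trans; ↭-reflexive; ↭-isEquivalence; ↭⇒↭ₛ)
open import Data.List.Relation.Binary.Permutation.Propositional.Properties
  using (∈-resp-↭; shift; drop-∷; ++⁺; ++⁺ˡ; ++⁺ʳ; ++-comm; ↭-singleton-inv; map⁺)
import Data.List.Relation.Binary.Permutation.Setoid.Properties as ↭ₛ
open import Data.List.Relation.Binary.Pointwise as Listᴾ using ([]; _∷_)
open import Data.List.Relation.Unary.All as All using (All; []; _∷_)
import Data.List.Relation.Unary.All.Properties as All
open import Data.List.Relation.Unary.Any as Any using (Any; here; there)
import Data.List.Relation.Unary.Any.Properties as Any
open import Data.List.Relation.Unary.Unique.Propositional using (Unique; []; _∷_)
import Data.List.Relation.Unary.Unique.Propositional.Properties as Unique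
open import Data.Nat using (ℕ; zero; suc; _+_; _*_; _≤_; _<_; z≤n; s≤s; _⊓_; _∸_; _≤?_; _<?_; _≟_)
open import Data.Nat.Properties
open import Data.Product using (Σ; ∃; ∃₂; _×_; _,_; proj₁; proj₂)
open import Data.Sum as Sum using (_⊎_; inj₁; inj₂; [_,_]′)
open import Data.Sum.Relation.Binary.Pointwise as Sumᴾ using (inj₁; inj₂)
open import Data.Unit using (⊤; tt)
open import Data.Vec as Vec using (Vec; []; _∷_; lookup; zipWith; replicate; _[_]≔_)
open import Data.Vec.Properties
  using (lookup-zipWith; lookup-map; lookup∘tabulate; lookup-replicate; []=⇒lookup; ≡-dec)
open import Data.Vec.Relation.Binary.Pointwise.Extensional using (ext; extensional⇒inductive)
open import Data.Vec.Relation.Binary.Pointwise.Inductive as Vecᴾ using (Pointwise; []; _∷_)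
open import Function.Bundles using (Injection; mk↣; _⇔_; mk⇔; Equivalence)
open import Function.Construct.Composition using (_↣-∘_)
open import Function.Properties.Inverse using (Inverse⇒Injection)
open import Level using (0ℓ)
open import Relation.Binary using (Rel; Decidable; Reflexive; Transitive; IsEquivalence)
open import Relation.Binary.Construct.Closure.ReflexiveTransitive using (Star; ε; _◅_; _◅◅_)
open import Relation.Binary.PropositionalEquality
  using (_≡_; refl; sym; trans; cong; cong₂; subst; subst₂; setoid; isEquivalence)
open import Relation.Nullary using (Dec; yes; no; ¬_)
open import Relation.Nullary.Decidable using (map′; ¬?; _×-dec_; _⊎-dec_; decidable-stable)

-- Almost-full relations

-- The tree form of "every infinite sequence has a related pair": once `x` has been seen, a later
-- `y` with `R x y` is as good as a related pair, so the relation grows along each branch until it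
-- is total.
data AF {X : Set} (R : Rel X 0ℓ) : Set₁ where
  now   : (∀ x y → R x y) → AF R
  later : (∀ x → AF (λ y z → R y z ⊎ R x y)) → AF R

AF-mono : ∀ {X} {R S : Rel X 0ℓ} → (∀ x y → R x y → S x y) → AF R → AF S
AF-mono R⇒S (now r)   = now λ x y → R⇒S x y (r x y)
AF-mono R⇒S (later p) = later λ x → AF-mono (λ y z → Sum.map (R⇒S y z) (R⇒S x y)) (p x)

AF-map : ∀ {X Y} {R : Rel X 0ℓ} {S : Rel Y 0ℓ} (f : Y → X) →
         (∀ x y → R (f x) (f y) → S x y) → AF R → AF S
AF-map f R⇒S (now r)   = now λ x y → R⇒S x y (r (f x) (f y))
AF-map f R⇒S (later p) = later λ x → AF-map f (λ y z → Sum.map (R⇒S y z) (R⇒S x y)) (p (f x))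

-- Coquand's intuitionistic Ramsey theorem raises the arity of `R` and `S` from propositions to
-- predicates to relations. Here they are propositions, and induction on the first tree suffices
-- because the arbitrary `C` absorbs the residuals.
AF-∩₀ : ∀ {X} {A B C : Rel X 0ℓ} {R S : Set} → AF A → AF B →
        (∀ x y → A x y → C x y ⊎ R) → (∀ x y → B x y → C x y ⊎ S) →
        AF (λ x y → C x y ⊎ (R × S))
AF-∩₀ (now a) q f g = AF-mono
  (λ x y b → [ inj₁ , (λ r → Sum.map₂ (r ,_) (g x y b)) ]′ (f x y (a x y))) q
AF-∩₀ (later p) q f g = later λ x → AF-mono
  (λ y z → [ Sum.map inj₁ inj₁ , (λ rs → inj₁ (inj₂ rs)) ]′)
  (AF-∩₀ (p x) q
    (λ y z → [ (λ a → Sum.map₁ inj₁ (f y z a)) , (λ a → Sum.map₁ inj₂ (f x y a)) ]′)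
    (λ y z b → Sum.map₁ inj₁ (g y z b)))

-- Induction on both trees. After `x`, lowering the first tree costs the proposition `R x` and
-- lowering the second costs `S x`; the nullary case merges the two results into one that pays only
-- when both hold.
AF-∩₁ : ∀ {X} {A B C : Rel X 0ℓ} {R S : X → Set} → AF A → AF B →
        (∀ x y → A x y → C x y ⊎ R x) → (∀ x y → B x y → C x y ⊎ S x) →
        AF (λ x y → C x y ⊎ (R x × S x))
AF-∩₁ (now a) q f g = AF-mono
  (λ x y b → [ inj₁ , (λ r → Sum.map₂ (r ,_) (g x y b)) ]′ (f x y (a x y))) q
AF-∩₁ (later p) (now b) f g = AF-mono
  (λ x y a → [ inj₁ , (λ s → Sum.map₂ (_, s) (f x y a)) ]′ (g x y (b x y))) (later p)
AF-∩₁ {C = C} {R} {S} (later p) (later q) f g = later λ x → AF-mono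
  (λ y z → λ where
    (inj₁ (inj₁ (inj₁ c))) → inj₁ (inj₁ c)
    (inj₁ (inj₁ (inj₂ c))) → inj₂ (inj₁ c)
    (inj₁ (inj₂ rs))       → inj₁ (inj₂ rs)
    (inj₂ rs)              → inj₂ (inj₂ rs))
  (AF-∩₀ {C = λ y z → (C y z ⊎ C x y) ⊎ (R y × S y)} {R x} {S x}
    (AF-∩₁ {C = λ y z → (C y z ⊎ C x y) ⊎ R x} {R} {S} (p x) (later q)
      (λ y z → λ where
        (inj₁ a) → Sum.map₁ (λ c → inj₁ (inj₁ c)) (f y z a)
        (inj₂ a) → inj₁ (Sum.map₁ inj₂ (f x y a)))
      (λ y z b → Sum.map₁ (λ c → inj₁ (inj₁ c)) (g y z b)))
    (AF-∩₁ {C = λ y z → (C y z ⊎ C x y) ⊎ S x} {R} {S} (later p) (q x)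
      (λ y z a → Sum.map₁ (λ c → inj₁ (inj₁ c)) (f y z a))
      (λ y z → λ where
        (inj₁ b) → Sum.map₁ (λ c → inj₁ (inj₁ c)) (g y z b)
        (inj₂ b) → inj₁ (Sum.map₁ inj₂ (g x y b))))
    (λ y z → λ where
      (inj₁ (inj₁ c)) → inj₁ (inj₁ c)
      (inj₁ (inj₂ r)) → inj₂ r
      (inj₂ rs)       → inj₁ (inj₂ rs))
    (λ y z → λ where
      (inj₁ (inj₁ c)) → inj₁ (inj₁ c)
      (inj₁ (inj₂ s)) → inj₂ s
      (inj₂ rs)       → inj₁ (inj₂ rs)))

AF-∩ : ∀ {X} {R S : Rel X 0ℓ} → AF R → AF S → AF (λ x y → R x y × S x y)
AF-∩ (now r)   q       = AF-mono (λ x y s → r x y , s) q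
AF-∩ (later p) (now s) = AF-mono (λ x y r → r , s x y) (later p)
AF-∩ {R = R} {S} (later p) (later q) = later λ x →
  -- With the first element fixed at `x`, the relations `R x` and `S x` are predicates, and the
  -- unary case yields exactly the residual of the intersection at `x`.
  AF-∩₁ {C = λ y z → R y z × S y z} {R x} {S x} (AF-∩ (p x) (later q)) (AF-∩ (later p) (q x))
    (λ where
      y z (inj₁ r , s) → inj₁ (r , s)
      y z (inj₂ r , s) → inj₂ r)
    (λ where
      y z (r , inj₁ s) → inj₁ (r , s)
      y z (r , inj₂ s) → inj₂ s)

AF-× : ∀ {X Y} {R : Rel X 0ℓ} {S : Rel Y 0ℓ} → AF R → AF S →
       AF {X × Y} (λ x y → R (proj₁ x) (proj₁ y) × S (proj₂ x) (proj₂ y))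
AF-× p q = AF-∩ (AF-map proj₁ (λ _ _ r → r) p) (AF-map proj₂ (λ _ _ s → s) q)

data Left {X Y : Set} (R : Rel X 0ℓ) : Rel (X ⊎ Y) 0ℓ where
  both  : ∀ {x x′} → R x x′ → Left R (inj₁ x) (inj₁ x′)
  skipˡ : ∀ {y z} → Left R (inj₂ y) z
  skipʳ : ∀ {y z} → Left R z (inj₂ y)

AF-Left : ∀ {X Y : Set} {R : Rel X 0ℓ} → AF R → AF (Left {X} {Y} R)
AF-Left (now r) = now λ where
  (inj₁ x) (inj₁ y) → both (r x y)
  (inj₁ x) (inj₂ y) → skipʳ
  (inj₂ x) y        → skipˡ
AF-Left {R = R} (later p) = later λ where
  (inj₁ x) → AF-mono
    (λ where
      _ _ (both (inj₁ r)) → inj₁ (both r)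
      _ _ (both (inj₂ r)) → inj₂ (both r)
      _ _ skipˡ             → inj₁ skipˡ
      _ _ skipʳ             → inj₁ skipʳ)
    (AF-Left (p x))
  (inj₂ x) → now λ _ _ → inj₂ skipˡ

data SameSide {X Y : Set} : Rel (X ⊎ Y) 0ℓ where
  left  : ∀ {x x′} → SameSide (inj₁ x) (inj₁ x′)
  right : ∀ {y y′} → SameSide (inj₂ y) (inj₂ y′)

-- Pigeonhole: of the three elements `x`, `y`, `z`, two lie on the same side.
AF-SameSide : ∀ {X Y} → AF (SameSide {X} {Y})
AF-SameSide = later λ x → later λ y → now (third x y)
  where
  third : ∀ x y z w → (SameSide z w ⊎ SameSide x z) ⊎ (SameSide y z ⊎ SameSide x y)
  third (inj₁ _) (inj₁ _) _        _ = inj₂ (inj₂ left)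
  third (inj₂ _) (inj₂ _) _        _ = inj₂ (inj₂ right)
  third (inj₁ _) (inj₂ _) (inj₁ _) _ = inj₁ (inj₂ left)
  third (inj₁ _) (inj₂ _) (inj₂ _) _ = inj₂ (inj₁ right)
  third (inj₂ _) (inj₁ _) (inj₁ _) _ = inj₂ (inj₁ left)
  third (inj₂ _) (inj₁ _) (inj₂ _) _ = inj₁ (inj₂ right)

-- By Ramsey, some pair is on one side and at the same time good for `Left R` and for `Left S`;
-- whichever side it is on, one of these two is informative.
AF-⊎ : ∀ {X Y} {R : Rel X 0ℓ} {S : Rel Y 0ℓ} → AF R → AF S → AF (Sumᴾ.Pointwise R S)
AF-⊎ p q = AF-mono
  (λ where
    _ _ (left , both r , _)  → inj₁ r
    _ _ (right , _ , both s) → inj₂ s)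
  (AF-∩ AF-SameSide (AF-∩ (AF-Left p) (AF-map Sum.swap (λ _ _ s → s) (AF-Left q))))

pred? : ℕ → ⊤ ⊎ ℕ
pred? zero    = inj₁ tt
pred? (suc n) = inj₂ n

-- Once `n` has been seen, only numbers below `n` remain to be handled. Induction on `n` removes one
-- successor from them, and zero is below everything.
AF-≤ : AF _≤_
AF-≤ = later above
  where
  above : ∀ n → AF (λ y z → y ≤ z ⊎ n ≤ y)
  above zero    = now λ _ _ → inj₂ z≤n
  above (suc n) = AF-map pred?
    (λ where
      zero    _       _        → inj₁ z≤n
      (suc y) (suc z) (inj₂ r) → Sum.map s≤s s≤s r)
    (AF-⊎ {R = λ (_ _ : ⊤) → ⊤} (now λ _ _ → tt) (above n))

-- Multiset embedding

removeAt-↭ : ∀ {T : Set} (N : List T) i → N ↭ List.lookup N i ∷ removeAt N i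
removeAt-↭ (x ∷ N)         zero    = ↭-refl
removeAt-↭ (x ∷ N@(_ ∷ _)) (suc i) = ↭-trans (prep x (removeAt-↭ N i)) (swap _ _ ↭-refl)

-- Multiset extension in a form suited to list induction: the injection is replaced by the list of
-- its values and the list of elements that it misses.
record Embedding {T : Set} (R : Rel T 0ℓ) (M N : List T) : Set where
  constructor embed
  field
    {image rest} : List T
    related      : Listᴾ.Pointwise R M image
    partition    : N ↭ image ++ rest

module _ {T : Set} {R : Rel T 0ℓ} where

  []-embeds : ∀ {N} → Embedding R [] N
  []-embeds = embed [] ↭-refl

  cons : ∀ {x z M N} → R x z → Embedding R M N → Embedding R (x ∷ M) (z ∷ N)
  cons r (embed p q) = embed (r ∷ p) (prep _ q)

  uncons : ∀ {x M N} → Embedding R (x ∷ M) N →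
           ∃₂ λ z N′ → R x z × N ↭ z ∷ N′ × Embedding R M N′
  uncons (embed (r ∷ p) q) = _ , _ , r , q , embed p ↭-refl

  respʳ : ∀ {M N N′} → N ↭ N′ → Embedding R M N → Embedding R M N′
  respʳ e (embed p q) = embed p (↭-trans (↭-sym e) q)

  Pointwise-↭ : ∀ {M M′ N} → M ↭ M′ → Listᴾ.Pointwise R M N → ∃ λ N′ → N ↭ N′ × Listᴾ.Pointwise R M′ N′
  Pointwise-↭ Perm.refl p = _ , ↭-refl , p
  Pointwise-↭ (prep x e) (r ∷ p) with Pointwise-↭ e p
  ... | _ , f , q = _ , prep _ f , r ∷ q
  Pointwise-↭ (swap x y e) (r ∷ s ∷ p) with Pointwise-↭ e p
  ... | _ , f , q = _ , swap _ _ f , s ∷ r ∷ q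
  Pointwise-↭ (Perm.trans e₁ e₂) p with Pointwise-↭ e₁ p
  ... | _ , f₁ , q with Pointwise-↭ e₂ q
  ... | _ , f₂ , q′ = _ , ↭-trans f₁ f₂ , q′

  respˡ : ∀ {M M′ N} → M ↭ M′ → Embedding R M N → Embedding R M′ N
  respˡ e (embed p q) with Pointwise-↭ e p
  ... | _ , f , p′ = embed p′ (↭-trans q (++⁺ʳ _ f))

  Pointwise-++⁻ : ∀ M {N P} → Listᴾ.Pointwise R (M ++ N) P →
                  ∃₂ λ P₁ P₂ → P ≡ P₁ ++ P₂ × Listᴾ.Pointwise R M P₁ × Listᴾ.Pointwise R N P₂
  Pointwise-++⁻ [] p = _ , _ , refl , [] , p
  Pointwise-++⁻ (x ∷ M) (r ∷ p) with Pointwise-++⁻ M p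
  ... | _ , _ , refl , p₁ , p₂ = _ , _ , refl , r ∷ p₁ , p₂

  weaken : ∀ {M N} P → Embedding R M N → Embedding R M (N ++ P)
  weaken P (embed {zs} {ws} p q) =
    embed p (↭-trans (++⁺ʳ P q) (↭-reflexive (++-assoc zs ws P)))

  weakenˡ : ∀ {M N} P → Embedding R M N → Embedding R M (P ++ N)
  weakenˡ {N = N} P e = respʳ (++-comm N P) (weaken P e)

  ++-embeds : ∀ {M N M′ N′} → Embedding R M N → Embedding R M′ N′ →
              Embedding R (M ++ M′) (N ++ N′)
  ++-embeds {M′ = M′} {N′} (embed {rest = ws} p q) e =
      respʳ (++⁺ʳ N′ (↭-sym q)) (go p)
    where
    go : ∀ {M zs} → Listᴾ.Pointwise R M zs → Embedding R (M ++ M′) ((zs ++ ws) ++ N′)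
    go []      = weakenˡ ws e
    go (r ∷ p) = cons r (go p)

∈-removable : ∀ {T : Set} {z : T} {N} → z ∈ N → ∃ λ N′ → N ↭ z ∷ N′
∈-removable z∈N with ∈-∃++ z∈N
... | xs , ys , refl = _ , shift _ xs ys

uncons-++ : ∀ {T : Set} {z : T} A {B N} → A ++ B ↭ z ∷ N →
            (∃ λ A′ → A ↭ z ∷ A′ × A′ ++ B ↭ N) ⊎ (∃ λ B′ → B ↭ z ∷ B′ × A ++ B′ ↭ N)
uncons-++ {z = z} A {B} e with ∈-++⁻ A (∈-resp-↭ (↭-sym e) (here refl))
... | inj₁ z∈A with ∈-removable z∈A
...   | A′ , f = inj₁ (A′ , f , drop-∷ (↭-trans (↭-sym (++⁺ʳ B f)) e))
uncons-++ {z = z} A {B} e | inj₂ z∈B with ∈-removable z∈B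
...   | B′ , f = inj₂ (B′ , f , drop-∷ (↭-trans (↭-sym (shift z A B′)) (↭-trans (++⁺ˡ A (↭-sym f)) e)))

module _ {T : Set} {R : Rel T 0ℓ} where

  -- Take the elements of M that the embedding sends into A.
  embed-++-split : ∀ M A B → Embedding R M (A ++ B) →
    ∃₂ λ M₁ M₂ → M ↭ M₁ ++ M₂ × Embedding R M₁ A × Embedding R M₂ B
  embed-++-split [] A B e = [] , [] , ↭-refl , []-embeds , []-embeds
  embed-++-split (x ∷ M) A B e with uncons e
  ... | z , N , r , f , e′ with uncons-++ A f
  ... | inj₁ (A′ , g , h) with embed-++-split M A′ B (respʳ (↭-sym h) e′)
  ...   | M₁ , M₂ , k , e₁ , e₂ = x ∷ M₁ , M₂ , prep x k , respʳ (↭-sym g) (cons r e₁) , e₂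
  embed-++-split (x ∷ M) A B e | z , N , r , f , e′ | inj₂ (B′ , g , h)
    with embed-++-split M A B′ (respʳ (↭-sym h) e′)
  ...   | M₁ , M₂ , k , e₁ , e₂ =
    M₁ , x ∷ M₂ , ↭-trans (prep x k) (↭-sym (shift x M₁ M₂)) , e₁ , respʳ (↭-sym g) (cons r e₂)

  -- The unmatched elements `ws` all go to the side of `A`, so `B` only grows element by element.
  -- Later `B` is what a rule consumes and `A` the bystanders.
  ++-embed-split : ∀ A B {N} → Embedding R (A ++ B) N →
    ∃₂ λ A′ B′ → Embedding R A A′ × Listᴾ.Pointwise R B B′ × N ↭ A′ ++ B′
  ++-embed-split A B (embed {rest = ws} p q) with Pointwise-++⁻ A p
  ... | zs₁ , zs₂ , refl , p₁ , p₂ = zs₁ ++ ws , zs₂ , embed p₁ ↭-refl , p₂ ,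
    ↭-trans q (↭-trans (↭-reflexive (++-assoc zs₁ zs₂ ws))
      (↭-trans (++⁺ˡ zs₁ (++-comm zs₂ ws)) (↭-reflexive (sym (++-assoc zs₁ ws zs₂)))))

  embedding? : Decidable R → Decidable (Embedding R)
  embedding? R? [] N = yes []-embeds
  embedding? R? (x ∷ M) N = map′
    (λ where (i , r , e) → respʳ (↭-sym (removeAt-↭ N i)) (cons r e))
    to
    (Fin.any? λ i → R? x (List.lookup N i) ×-dec embedding? R? M (removeAt N i))
    where
    to : Embedding R (x ∷ M) N → ∃ λ i → R x (List.lookup N i) × Embedding R M (removeAt N i)
    to e with uncons e
    ... | z , N′ , r , f , e′ = i , subst (R x) (sym z≡) r , respʳ (drop-∷ g) e′
      where
      z∈N = ∈-resp-↭ (↭-sym f) (here refl)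
      i = Any.index z∈N
      z≡ = sym (Any.lookup-index z∈N)
      g : z ∷ N′ ↭ z ∷ removeAt N i
      g = ↭-trans (↭-sym f) (subst (λ y → N ↭ y ∷ removeAt N i) z≡ (removeAt-↭ N i))

  embedding-refl : Reflexive R → ∀ {M N} → M ↭ N → Embedding R M N
  embedding-refl R-refl {M} e =
    embed {rest = []} (Listᴾ.refl R-refl) (↭-trans (↭-sym e) (++-comm [] M))

  embedding-trans : Transitive R → Transitive (Embedding R)
  embedding-trans R-trans (embed {image = zs} p q) e with respˡ q e
  ... | embed p′ q′ with Pointwise-++⁻ zs p′
  ... | z₁ , z₂ , refl , p₁ , p₂ =
    embed (Listᴾ.transitive R-trans p p₁) (↭-trans q′ (↭-reflexive (++-assoc z₁ z₂ _)))

Residual : {T : Set} → Rel T 0ℓ → T → Rel T 0ℓ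
Residual R x y z = R y z ⊎ R x y

embedding-avoiding : ∀ {T : Set} {R : Rel T 0ℓ} {x M N} → All (λ y → ¬ R x y) M →
                     Embedding (Residual R x) M N → Embedding R M N
embedding-avoiding avoid (embed p q) = embed (go avoid p) q
  where
  go : ∀ {M N} → All (λ y → ¬ _ ) M → Listᴾ.Pointwise (Residual _ _) M N → Listᴾ.Pointwise _ M N
  go []       []           = []
  go (a ∷ as) (inj₁ r ∷ p) = r ∷ go as p
  go (a ∷ as) (inj₂ r ∷ p) = ⊥-elim (a r)

-- Higman's lemma for multisets.  Once L = x ∷ L′ has been seen, a later M either has an element
-- y above x, and y is split off to leave a multiset to be compared with L′, or it avoids x, and
-- there R agrees with its residual at x, which is lower in the proof that R is almost full.
AF-Embedding : ∀ {T : Set} {R : Rel T 0ℓ} → Decidable R → AF R → AF (Embedding R)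
AF-Embedding {R = R} R? (now r) = AF-map length short AF-≤
  where
  -- Any two elements are related, so only the number of elements matters.
  short : ∀ M N → length M ≤ length N → Embedding R M N
  short []      N       le       = []-embeds
  short (x ∷ M) (y ∷ N) (s≤s le) = cons (r x y) (short M N le)
AF-Embedding {T} {R} R? p₀@(later p) = later avoiding
  where
  avoiding : ∀ L → AF (λ M N → Embedding R M N ⊎ Embedding R L M)
  avoiding []      = now λ _ _ → inj₂ []-embeds
  avoiding (x ∷ L) = AF-map code decode
    (AF-⊎ (AF-× p₀ (avoiding L)) (AF-Embedding (λ y z → R? y z ⊎-dec R? x y) (p x)))
    where
    View : List T → Set
    View M = (∃₂ λ y M′ → R x y × M ↭ y ∷ M′) ⊎ All (λ y → ¬ R x y) M

    view : ∀ M → View M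
    view M with Any.any? (R? x) M
    ... | no none   = inj₂ (All.¬Any⇒All¬ M none)
    ... | yes found = inj₁ (_ , _ , Any.lookup-result found , removeAt-↭ M (Any.index found))

    encode : ∀ {M} → View M → (T × List T) ⊎ List T
    encode     (inj₁ (y , M′ , _)) = inj₁ (y , M′)
    encode {M} (inj₂ _)            = inj₂ M

    code : List T → (T × List T) ⊎ List T
    code M = encode (view M)

    decode : ∀ M N → Sumᴾ.Pointwise _ _ (code M) (code N) → Embedding R M N ⊎ Embedding R (x ∷ L) M
    decode M N r with view M | view N
    decode M N (inj₁ (r , inj₁ e)) | inj₁ (_ , _ , _ , f) | inj₁ (_ , _ , _ , g) =
      inj₁ (respˡ (↭-sym f) (respʳ (↭-sym g) (cons r e)))
    -- The remainder of `M` lies above `L` and its split-off element lies above `x`, so `M` lies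
    -- above `x ∷ L`.
    decode M N (inj₁ (r , inj₂ e)) | inj₁ (_ , _ , s , f) | inj₁ _ =
      inj₂ (respʳ (↭-sym f) (cons s e))
    decode M N (inj₂ e) | inj₂ avoid | inj₂ _ = inj₁ (embedding-avoiding avoid e)

-- Ordered resources

-- _⊑_ is the part of _≼_ that adds nothing new: the growth that a component already
-- present may undergo.
record Resource (A : Set) : Set₁ where
  infix 4 _≈_ _≼_ _⊑_
  infixl 6 _∙_
  field
    _≈_ _≼_ _⊑_     : Rel A 0ℓ
    _∙_             : A → A → A
    weight          : A → ℕ
    enumerate       : ℕ → List A
    ≈-isEquivalence : IsEquivalence _≈_
    ∙-cong          : ∀ {a b c d} → a ≈ b → c ≈ d → a ∙ c ≈ b ∙ d
    ∙-comm          : ∀ a b → a ∙ b ≈ b ∙ a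
    ≼-reflexive     : ∀ {a b} → a ≈ b → a ≼ b
    ≼-trans         : Transitive _≼_
    ∙-mono          : ∀ {a b c d} → a ≼ b → c ≼ d → a ∙ c ≼ b ∙ d
    _≼?_            : Decidable _≼_
    ≼-AF            : AF _≼_
    -- Transports a firing to a larger configuration: the surplus of `u` is credited to the
    -- bystanders `a`, and the consumed part `b` merely grows.
    ∙-splitˡ        : ∀ a b {u} → a ∙ b ≼ u → ∃₂ λ a′ b′ → a ≼ a′ × b ⊑ b′ × u ≈ a′ ∙ b′
    -- The part of `a` that helps to cover `t` need not outweigh `t`, which makes the search for
    -- small predecessors finite.
    ≼-∙-split       : ∀ t a b → t ≼ a ∙ b → ∃ λ a′ → a′ ≼ a × weight a′ ≤ weight t × t ≼ a′ ∙ b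
    weight-∙        : ∀ a b → weight (a ∙ b) ≡ weight a + weight b
    weight-mono     : ∀ {a b} → a ≼ b → weight a ≤ weight b
    -- Reduces `≈` to `≼` and a comparison of weights: growth that keeps the weight is no growth.
    weight-tight    : ∀ {a b} → a ≼ b → weight b ≤ weight a → a ≈ b
    enumerate-∈     : ∀ k a → weight a ≤ k → a ∈ enumerate k

  open IsEquivalence ≈-isEquivalence public
    renaming (refl to ≈-refl; sym to ≈-sym; trans to ≈-trans)

  ≼-refl : Reflexive _≼_
  ≼-refl = ≼-reflexive ≈-refl

  weight-≈ : ∀ {a b} → a ≈ b → weight a ≡ weight b
  weight-≈ e = ≤-antisym (weight-mono (≼-reflexive e)) (weight-mono (≼-reflexive (≈-sym e)))

  _≈?_ : Decidable _≈_
  a ≈? b = map′ (λ (p , le) → weight-tight p le)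
                (λ e → ≼-reflexive e , ≤-reflexive (sym (weight-≈ e)))
                ((a ≼? b) ×-dec (weight b ≤? weight a))

squeeze : ∀ {a b c d} → a ≤ c → b ≤ d → c + d ≤ a + b → c ≤ a × d ≤ b
squeeze {a} {b} {c} {d} a≤c b≤d le =
  +-cancelʳ-≤ d c a (≤-trans le (+-monoʳ-≤ a b≤d)) ,
  +-cancelˡ-≤ c d b (≤-trans le (+-monoˡ-≤ b a≤c))

-- Numbers and vectors as resources

ℕ-resource : Resource ℕ
ℕ-resource = record
  { _≈_ = _≡_ ; _≼_ = _≤_ ; _⊑_ = _≡_ ; _∙_ = _+_
  ; weight = λ n → n
  ; enumerate = λ k → upTo (suc k)
  ; ≈-isEquivalence = isEquivalence
  ; ∙-cong = cong₂ _+_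
  ; ∙-comm = +-comm
  ; ≼-reflexive = ≤-reflexive
  ; ≼-trans = ≤-trans
  ; ∙-mono = +-mono-≤
  ; _≼?_ = _≤?_
  ; ≼-AF = AF-≤
  ; ∙-splitˡ = λ a b {u} a+b≤u → u ∸ b , b , m+n≤o⇒m≤o∸n a a+b≤u , refl ,
      sym (m∸n+n≡m (≤-trans (m≤n+m b a) a+b≤u))
  -- Minimum distributes over addition of `b`, so `(a ⊓ t) + b` is the minimum of `a + b` and
  -- `t + b`, both at least `t`.
  ; ≼-∙-split = λ t a b t≤a+b → a ⊓ t , m⊓n≤m a t , m⊓n≤n a t ,
      ≤-trans (⊓-glb t≤a+b (m≤m+n t b)) (≤-reflexive (sym (+-distribʳ-⊓ b a t)))
  ; weight-∙ = λ _ _ → refl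
  ; weight-mono = λ a≤b → a≤b
  ; weight-tight = ≤-antisym
  ; enumerate-∈ = λ k a a≤k → ∈-upTo⁺ (s≤s a≤k)
  }

AF-Vec : ∀ {A : Set} {R : Rel A 0ℓ} → AF R → ∀ n → AF (Pointwise R {n} {n})
AF-Vec p zero    = now λ where [] [] → []
AF-Vec p (suc n) = AF-map (λ where (x ∷ xs) → x , xs)
  (λ where (x ∷ xs) (y ∷ ys) (r , rs) → r ∷ rs) (AF-× p (AF-Vec p n))

vecWeight : ∀ {A : Set} → (A → ℕ) → ∀ {n} → Vec A n → ℕ
vecWeight w []       = 0
vecWeight w (x ∷ xs) = w x + vecWeight w xs

vectors : {A : Set} → List A → ∀ n → List (Vec A n)
vectors xs zero    = [ [] ]
vectors xs (suc n) = cartesianProductWith _∷_ xs (vectors xs n)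

-- Each element counts one more than its own weight, so that empty tokens also count and the weight
-- bounds the length.
listWeight : {A : Set} → (A → ℕ) → List A → ℕ
listWeight w []       = 0
listWeight w (x ∷ xs) = suc (w x) + listWeight w xs

lists : {A : Set} → List A → ℕ → List (List A)
lists xs zero    = [ [] ]
lists xs (suc n) = [] ∷ cartesianProductWith _∷_ xs (lists xs n)

module _ {A : Set} (𝓐 : Resource A) where
  private
    open module 𝓐 = Resource 𝓐 using (_∙_; _≈_; _≼_; _⊑_; weight; enumerate)

    total : ∀ {n} → Vec A n → ℕ
    total = vecWeight weight

    zipWith-mono : ∀ {R : Rel A 0ℓ} → (∀ {a b c d} → R a b → R c d → R (a ∙ c) (b ∙ d)) →
      ∀ {n} {as bs cs ds : Vec A n} → Pointwise R as bs → Pointwise R cs ds →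
      Pointwise R (zipWith _∙_ as cs) (zipWith _∙_ bs ds)
    zipWith-mono f []       []       = []
    zipWith-mono f (r ∷ rs) (s ∷ ss) = f r s ∷ zipWith-mono f rs ss

    comm : ∀ {n} (as bs : Vec A n) → Pointwise _≈_ (zipWith _∙_ as bs) (zipWith _∙_ bs as)
    comm []       []       = []
    comm (a ∷ as) (b ∷ bs) = 𝓐.∙-comm a b ∷ comm as bs

    splitˡ : ∀ {n} (as bs : Vec A n) {us : Vec A n} → Pointwise _≼_ (zipWith _∙_ as bs) us →
      ∃₂ λ (as′ bs′ : Vec A n) → Pointwise _≼_ as as′ × Pointwise _⊑_ bs bs′ ×
                     Pointwise _≈_ us (zipWith _∙_ as′ bs′)
    splitˡ []       []       []       = [] , [] , [] , [] , []
    splitˡ (a ∷ as) (b ∷ bs) (r ∷ rs) with 𝓐.∙-splitˡ a b r | splitˡ as bs rs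
    ... | _ , _ , p , q , e | _ , _ , ps , qs , es = _ , _ , p ∷ ps , q ∷ qs , e ∷ es

    splitʳ : ∀ {n} (ts as bs : Vec A n) → Pointwise _≼_ ts (zipWith _∙_ as bs) →
      ∃ λ (as′ : Vec A n) → Pointwise _≼_ as′ as × total as′ ≤ total ts ×
                Pointwise _≼_ ts (zipWith _∙_ as′ bs)
    splitʳ []       []       []       []       = [] , [] , z≤n , []
    splitʳ (t ∷ ts) (a ∷ as) (b ∷ bs) (r ∷ rs) with 𝓐.≼-∙-split t a b r | splitʳ ts as bs rs
    ... | _ , p , le , q | _ , ps , les , qs = _ , p ∷ ps , +-mono-≤ le les , q ∷ qs

    total-∙ : ∀ {n} (as bs : Vec A n) → total (zipWith _∙_ as bs) ≡ total as + total bs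
    total-∙ []       []       = refl
    total-∙ (a ∷ as) (b ∷ bs) = trans (cong₂ _+_ (𝓐.weight-∙ a b) (total-∙ as bs))
      (interchange +-commutativeSemigroup (weight a) (weight b) (total as) (total bs))

    total-mono : ∀ {n} {as bs : Vec A n} → Pointwise _≼_ as bs → total as ≤ total bs
    total-mono []       = z≤n
    total-mono (r ∷ rs) = +-mono-≤ (𝓐.weight-mono r) (total-mono rs)

    total-tight : ∀ {n} {as bs : Vec A n} → Pointwise _≼_ as bs → total bs ≤ total as →
      Pointwise _≈_ as bs
    total-tight []       le = []
    total-tight (r ∷ rs) le with squeeze (𝓐.weight-mono r) (total-mono rs) le
    ... | le₁ , le₂ = 𝓐.weight-tight r le₁ ∷ total-tight rs le₂

    vectors-∈ : ∀ {n} k (as : Vec A n) → total as ≤ k → as ∈ vectors (enumerate k) n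
    vectors-∈ k []       le = here refl
    vectors-∈ k (a ∷ as) le = ∈-cartesianProductWith⁺ _∷_
      (𝓐.enumerate-∈ k a (m+n≤o⇒m≤o _ le)) (vectors-∈ k as (m+n≤o⇒n≤o (weight a) le))

  Vec-resource : ∀ n → Resource (Vec A n)
  Vec-resource n = record
    { _≈_ = Pointwise _≈_ ; _≼_ = Pointwise _≼_ ; _⊑_ = Pointwise _⊑_ ; _∙_ = zipWith _∙_
    ; weight = total
    ; enumerate = λ k → vectors (enumerate k) n
    ; ≈-isEquivalence = Vecᴾ.isEquivalence 𝓐.≈-isEquivalence n
    ; ∙-cong = zipWith-mono 𝓐.∙-cong
    ; ∙-comm = comm
    ; ≼-reflexive = Vecᴾ.map 𝓐.≼-reflexive
    ; ≼-trans = Vecᴾ.trans 𝓐.≼-trans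
    ; ∙-mono = zipWith-mono 𝓐.∙-mono
    ; _≼?_ = Vecᴾ.decidable 𝓐._≼?_
    ; ≼-AF = AF-Vec 𝓐.≼-AF n
    ; ∙-splitˡ = splitˡ
    ; ≼-∙-split = splitʳ
    ; weight-∙ = total-∙
    ; weight-mono = total-mono
    ; weight-tight = total-tight
    ; enumerate-∈ = vectors-∈
    }

-- Finite multisets as a resource

module _ {T : Set} {_≤ᵀ_ : Rel T 0ℓ} (≤ᵀ-refl : Reflexive _≤ᵀ_) (≤ᵀ-trans : Transitive _≤ᵀ_)
         (_≤ᵀ?_ : Decidable _≤ᵀ_) (≤ᵀ-AF : AF _≤ᵀ_)
         (size : T → ℕ) (size-mono : ∀ {x y} → x ≤ᵀ y → size x ≤ size y)
         (size-tight : ∀ {x y} → x ≤ᵀ y → size y ≤ size x → x ≡ y)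
         (elements : ℕ → List T) (elements-∈ : ∀ k x → size x ≤ k → x ∈ elements k) where
  private
    total : List T → ℕ
    total = listWeight size

    total-++ : ∀ M N → total (M ++ N) ≡ total M + total N
    total-++ []      N = refl
    total-++ (x ∷ M) N = trans (cong (suc (size x) +_) (total-++ M N))
                               (sym (+-assoc (suc (size x)) (total M) (total N)))

    total-↭ : ∀ {M N} → M ↭ N → total M ≡ total N
    total-↭ Perm.refl         = refl
    total-↭ (prep x e)        = cong (suc (size x) +_) (total-↭ e)
    total-↭ (swap x y e)      = trans (x∙yz≈y∙xz +-commutativeSemigroup (suc (size x)) (suc (size y)) _)
      (cong (λ n → suc (size y) + (suc (size x) + n)) (total-↭ e))
    total-↭ (Perm.trans e₁ e₂) = trans (total-↭ e₁) (total-↭ e₂)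

    total-Pointwise : ∀ {M N} → Listᴾ.Pointwise _≤ᵀ_ M N → total M ≤ total N
    total-Pointwise []       = z≤n
    total-Pointwise (r ∷ rs) = +-mono-≤ (s≤s (size-mono r)) (total-Pointwise rs)

    total-tight-Pointwise : ∀ {M N} → Listᴾ.Pointwise _≤ᵀ_ M N → total N ≤ total M → M ≡ N
    total-tight-Pointwise []       le = refl
    total-tight-Pointwise (r ∷ rs) le with squeeze (s≤s (size-mono r)) (total-Pointwise rs) le
    ... | s≤s le₁ , le₂ = cong₂ _∷_ (size-tight r le₁) (total-tight-Pointwise rs le₂)

    total-mono : ∀ {M N} → Embedding _≤ᵀ_ M N → total M ≤ total N
    total-mono {M} {N} (embed {image} {rest} p q) = ≤-trans (total-Pointwise p)
      (≤-trans (m≤m+n _ (total rest))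
        (≤-reflexive (sym (trans (total-↭ q) (total-++ image rest)))))

    total-tight : ∀ {M N} → Embedding _≤ᵀ_ M N → total N ≤ total M → M ↭ N
    total-tight {M} {N} (embed {image} {[]} p q) le = ↭-trans
      (↭-reflexive (total-tight-Pointwise p (subst (_≤ total M)
        (trans (total-↭ q) (cong total (++-identityʳ image))) le)))
      (↭-trans (++-comm [] image) (↭-sym q))
    -- A missed element weighs at least one, so `N` would be strictly heavier.
    total-tight {M} {N} (embed {image} {x ∷ rest} p q) le =
      ⊥-elim (<-irrefl refl (begin-strict
        total M                       ≤⟨ total-Pointwise p ⟩
        total image                   <⟨ m<m+n _ (s≤s z≤n) ⟩
        total image + total (x ∷ rest) ≡⟨ total-++ image (x ∷ rest) ⟨
        total (image ++ x ∷ rest)     ≡⟨ total-↭ q ⟨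
        total N                       ≤⟨ le ⟩
        total M                       ∎))
      where open ≤-Reasoning

    splitʳ : ∀ M A B → Embedding _≤ᵀ_ M (A ++ B) →
      ∃ λ A′ → Embedding _≤ᵀ_ A′ A × total A′ ≤ total M × Embedding _≤ᵀ_ M (A′ ++ B)
    splitʳ M A B e with embed-++-split M A B e
    -- The witness consists of elements of `M` itself, not of their images in `A`; this bounds its
    -- weight by that of `M`.
    ... | M₁ , M₂ , f , e₁ , e₂ = M₁ , e₁ ,
      ≤-trans (m≤m+n _ (total M₂)) (≤-reflexive (sym (trans (total-↭ f) (total-++ M₁ M₂)))) ,
      respˡ (↭-sym f) (++-embeds (embedding-refl ≤ᵀ-refl ↭-refl) e₂)

    -- The bound is split in two: `j` decreases with the length, while `k` stays fixed as the bound
    -- on the elements.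
    lists-∈ : ∀ j k M → total M ≤ j → total M ≤ k → M ∈ lists (elements k) j
    lists-∈ zero    k []      le le′ = here refl
    lists-∈ (suc j) k []      le le′ = here refl
    lists-∈ (suc j) k (x ∷ M) (s≤s le) le′ = there (∈-cartesianProductWith⁺ _∷_
      (elements-∈ k x (≤-trans (n≤1+n _) (m+n≤o⇒m≤o _ le′)))
      (lists-∈ j k M (m+n≤o⇒n≤o (size x) le) (m+n≤o⇒n≤o (suc (size x)) le′)))

  Multiset-resource : Resource (List T)
  Multiset-resource = record
    { _≈_ = _↭_ ; _≼_ = Embedding _≤ᵀ_ ; _⊑_ = Listᴾ.Pointwise _≤ᵀ_ ; _∙_ = _++_
    ; weight = total
    ; enumerate = λ k → lists (elements k) k
    ; ≈-isEquivalence = ↭-isEquivalence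
    ; ∙-cong = ++⁺
    ; ∙-comm = ++-comm
    ; ≼-reflexive = embedding-refl ≤ᵀ-refl
    ; ≼-trans = embedding-trans ≤ᵀ-trans
    ; ∙-mono = ++-embeds
    ; _≼?_ = embedding? _≤ᵀ?_
    ; ≼-AF = AF-Embedding _≤ᵀ?_ ≤ᵀ-AF
    ; ∙-splitˡ = λ A B → ++-embed-split A B
    ; ≼-∙-split = splitʳ
    ; weight-∙ = total-++
    ; weight-mono = total-mono
    ; weight-tight = total-tight
    ; enumerate-∈ = λ k M le → lists-∈ k k M le le
    }

-- Tokens

pointwise : ∀ {A : Set} {R : Rel A 0ℓ} {n} {xs ys : Vec A n} →
            (∀ i → R (lookup xs i) (lookup ys i)) → Pointwise R xs ys
pointwise f = extensional⇒inductive (ext f)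

infix 4 _⊴_

_⊴_ : Rel ℕ 0ℓ
a ⊴ b = (0 ≡ a × a ≡ b) ⊎ (0 < a × a ≤ b)

⊴-refl : Reflexive _⊴_
⊴-refl {zero}  = inj₁ (refl , refl)
⊴-refl {suc a} = inj₂ (s≤s z≤n , ≤-refl)

⊴-trans : Transitive _⊴_
⊴-trans (inj₁ (refl , refl)) q                    = q
⊴-trans (inj₂ (p , q))       (inj₁ (refl , refl)) = ⊥-elim (<⇒≱ p q)
⊴-trans (inj₂ (p , q))       (inj₂ (_ , q′))      = inj₂ (p , ≤-trans q q′)

⊴⇒≤ : ∀ {a b} → a ⊴ b → a ≤ b
⊴⇒≤ (inj₁ (_ , refl)) = ≤-refl
⊴⇒≤ (inj₂ (_ , q))    = q

_⊴?_ : Decidable _⊴_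
a ⊴? b = ((0 ≟ a) ×-dec (a ≟ b)) ⊎-dec ((0 <? a) ×-dec (a ≤? b))

-- The order is the disjoint sum of the point zero and the positive numbers under `≤`.
AF-⊴ : AF _⊴_
AF-⊴ = AF-map pred?
  (λ where
    zero    zero    _        → inj₁ (refl , refl)
    (suc a) (suc b) (inj₂ r) → inj₂ (s≤s z≤n , s≤s r))
  (AF-⊎ {R = λ (_ _ : ⊤) → ⊤} (now λ _ _ → tt) AF-≤)

⊴-+ : ∀ {a b} c → a ⊴ b → a + c ⊴ b + c
⊴-+ c (inj₁ (refl , refl)) = ⊴-refl
⊴-+ c (inj₂ (p , q))       = inj₂ (m≤n⇒m≤n+o c p , +-monoˡ-≤ c q)

⊓-⊴ : ∀ k a → suc k ⊓ a ⊴ a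
⊓-⊴ k zero    = inj₁ (refl , refl)
⊓-⊴ k (suc a) = inj₂ (s≤s z≤n , m⊓n≤n (suc k) (suc a))

-- A value at most `k` cannot notice a cap at `suc k`. The cap is not `k`, because for `k = 0` a
-- positive `a` would become zero and leave its class.
⊴-⊓ : ∀ {k x a} c → x ≤ k → x ⊴ a + c → x ⊴ (suc k ⊓ a) + c
⊴-⊓ {a = zero}      c x≤k r = r
⊴-⊓ {a = suc a}     c x≤k (inj₁ (refl , ()))
⊴-⊓ {k} {x} {suc a} c x≤k (inj₂ (p , q)) = inj₂ (p ,
  ≤-trans (⊓-glb (≤-trans (≤-trans x≤k (n≤1+n k)) (m≤m+n (suc k) c)) q)
    (≤-reflexive (sym (+-distribʳ-⊓ c (suc k) (suc a)))))

tokens : ∀ n → Resource (Token n)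
tokens = Vec-resource ℕ-resource

size : Token nⁱ → ℕ
size = Resource.weight (tokens _)

lookup≤size : ∀ (m : Vec ℕ nⁱ) c → lookup m c ≤ size m
lookup≤size (x ∷ m) zero    = m≤m+n x (size m)
lookup≤size (x ∷ m) (suc c) = m≤n⇒m≤o+n x (lookup≤size m c)

size-𝟎 : ∀ n → size (𝟎 {n}) ≡ 0
size-𝟎 zero    = refl
size-𝟎 (suc n) = size-𝟎 n

≤ᴵ⇒Pointwise-≤ : {m m′ : Token nⁱ} → m ≤ᴵ m′ → Pointwise _≤_ m m′
≤ᴵ⇒Pointwise-≤ le = pointwise (λ c → ⊴⇒≤ (le c))

≤ᴵ-tight : {m m′ : Token nⁱ} → m ≤ᴵ m′ → size m′ ≤ size m → m ≡ m′
≤ᴵ-tight le le′ = Vecᴾ.Pointwise-≡⇒≡ (Resource.weight-tight (tokens _) (≤ᴵ⇒Pointwise-≤ le) le′)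

_≤ᴵ?_ : Decidable (_≤ᴵ_ {nⁱ})
m ≤ᴵ? m′ = Fin.all? λ c → lookup m c ⊴? lookup m′ c

AF-≤ᴵ : AF (_≤ᴵ_ {nⁱ})
AF-≤ᴵ = AF-mono (λ _ _ r c → Vecᴾ.lookup r c) (AF-Vec AF-⊴ _)

-- The order preserves zero multiplicities, so an empty token cannot grow. This is why simple rules
-- may consume empty tokens.
𝟎≤ᴵ⇒≡ : {m : Token nⁱ} → 𝟎 ≤ᴵ m → 𝟎 ≡ m
𝟎≤ᴵ⇒≡ {m = m} le = Vecᴾ.Pointwise-≡⇒≡ (pointwise λ c → go (lookup-replicate c 0) (le c))
  where
  go : ∀ {a b} → a ≡ 0 → a ⊴ b → a ≡ b
  go _    (inj₁ (_ , e)) = e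
  go refl (inj₂ (() , _))

truncate : ℕ → Token nⁱ → Token nⁱ
truncate k = Vec.map (suc k ⊓_)

truncate-≤ᴵ : ∀ k (m : Token nⁱ) → truncate k m ≤ᴵ m
truncate-≤ᴵ k m c rewrite lookup-map c (suc k ⊓_) m = ⊓-⊴ k (lookup m c)

size-truncate : ∀ k (m : Token nⁱ) → size (truncate k m) ≤ nⁱ * suc k
size-truncate k []      = z≤n
size-truncate k (x ∷ m) = +-mono-≤ (m⊓n≤m (suc k) x) (size-truncate k m)

⊕ₜ-mono : ∀ (m m′ : Token nⁱ) 𝔠 → m ≤ᴵ m′ → m ⊕ₜ 𝔠 ≤ᴵ m′ ⊕ₜ 𝔠
⊕ₜ-mono m m′ 𝔠 le c
  rewrite lookup-zipWith _+_ c m 𝔠 | lookup-zipWith _+_ c m′ 𝔠 = ⊴-+ (lookup 𝔠 c) (le c)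

⊕ₜ-truncate : ∀ {k} {σ m : Token nⁱ} 𝔠 → size σ ≤ k → σ ≤ᴵ m ⊕ₜ 𝔠 → σ ≤ᴵ truncate k m ⊕ₜ 𝔠
⊕ₜ-truncate {k = k} {σ} {m} 𝔠 σ≤k le c with le c
... | r rewrite lookup-zipWith _+_ c m 𝔠 | lookup-zipWith _+_ c (truncate k m) 𝔠
              | lookup-map c (suc k ⊓_) m =
  ⊴-⊓ (lookup 𝔠 c) (≤-trans (lookup≤size σ c) σ≤k) r

module _ {n : ℕ} (Q : Subset n) where
  lookup-↾ : ∀ (m : Token n) c → lookup (m ↾ Q) c ≡ (if lookup Q c then lookup m c else 0)
  lookup-↾ m c = lookup-zipWith _ c m Q

  ↾-mono : ∀ (m m′ : Token n) → m ≤ᴵ m′ → m ↾ Q ≤ᴵ m′ ↾ Q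
  ↾-mono m m′ le c rewrite lookup-↾ m c | lookup-↾ m′ c with lookup Q c
  ... | true  = le c
  ... | false = ⊴-refl

  ↾-truncate : ∀ {k} {σ m : Token n} → size σ ≤ k → σ ≤ᴵ m ↾ Q → σ ≤ᴵ truncate k m ↾ Q
  ↾-truncate {k} {σ} {m} σ≤k le c with le c
  ... | r rewrite lookup-↾ m c | lookup-↾ (truncate k m) c | lookup-map c (suc k ⊓_) m
          with lookup Q c
  ...   | true  = subst (lookup σ c ⊴_) (+-identityʳ _)
                    (⊴-⊓ 0 (≤-trans (lookup≤size σ c) σ≤k)
                      (subst (lookup σ c ⊴_) (sym (+-identityʳ _)) r))
  ...   | false = r

module _ (ζ : Fin nⁱ → Fin nˢ) (P : Subset nⁱ) where

  -- The colour found by the search depends only on `ζ`, `P` and `p`, so both tokens are read at the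
  -- same colour.
  ejectAt-mono : ∀ {m m′} → Pointwise _≤_ m m′ → ∀ p → ejectAt ζ P m p ≤ ejectAt ζ P m′ p
  ejectAt-mono le p with Fin.any? (λ c → (c Subset.∈? P) ×-dec (ζ c Fin.≟ p))
  ... | yes (c , _) = Vecᴾ.lookup le c
  ... | no _        = z≤n

  eject-mono : ∀ m m′ → m ≤ᴵ m′ → Pointwise _≤_ (eject ζ P m) (eject ζ P m′)
  eject-mono m m′ le = Vecᴾ.tabulate⁺ (ejectAt-mono (≤ᴵ⇒Pointwise-≤ le))

  ejectAt-truncate : ∀ {k x} m p → x ≤ k → x ≤ ejectAt ζ P m p → x ≤ ejectAt ζ P (truncate k m) p
  ejectAt-truncate {k} m p x≤k le with Fin.any? (λ c → (c Subset.∈? P) ×-dec (ζ c Fin.≟ p))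
  ... | yes (c , _) rewrite lookup-map c (suc k ⊓_) m = ⊓-glb (≤-trans x≤k (n≤1+n k)) le
  ... | no _        = le

  eject-truncate : ∀ {k v m} → size v ≤ k → Pointwise _≤_ v (eject ζ P m) →
                   Pointwise _≤_ v (eject ζ P (truncate k m))
  eject-truncate {k} {v} {m} v≤k le = pointwise λ p →
    subst (lookup v p ≤_) (sym (lookup∘tabulate _ p))
      (ejectAt-truncate m p (≤-trans (lookup≤size v p) v≤k)
        (subst (lookup v p ≤_) (lookup∘tabulate _ p) (Vecᴾ.lookup le p)))

  module _ (inj : InjectiveOn ζ P) where

    ejectAt-ζ : ∀ {c} m → c Subset.∈ P → ejectAt ζ P m (ζ c) ≡ lookup m c
    ejectAt-ζ {c} m c∈P with Fin.any? (λ c′ → (c′ Subset.∈? P) ×-dec (ζ c′ Fin.≟ ζ c))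
    ... | yes (c′ , c′∈P , e) = cong (lookup m) (inj c′∈P c∈P e)
    ... | no none             = ⊥-elim (none (c , c∈P , refl))

    -- A colour in `P` can be read off at its place, to which injectivity lets no other colour of
    -- `P` contribute; a colour outside `P` is still in the token.
    transfer-injective : ∀ {m m′} → eject ζ P m ≡ eject ζ P m′ → m ↾ ∁ P ≡ m′ ↾ ∁ P → m ≡ m′
    transfer-injective {m} {m′} e f = Vecᴾ.Pointwise-≡⇒≡ (pointwise go)
      where
      go : ∀ c → lookup m c ≡ lookup m′ c
      go c with c Subset.∈? P
      ... | yes c∈P = trans (sym (ejectAt-ζ m c∈P)) (trans
              (subst₂ _≡_ (lookup∘tabulate _ (ζ c)) (lookup∘tabulate _ (ζ c))
                (cong (λ v → lookup v (ζ c)) e))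
              (ejectAt-ζ m′ c∈P))
      ... | no c∉P = trans (sym (kept m)) (trans (cong (λ v → lookup v c) f) (kept m′))
        where
        kept : ∀ m → lookup (m ↾ ∁ P) c ≡ lookup m c
        kept m = trans (lookup-↾ (∁ P) m c) (cong (if_then lookup m c else 0)
          ([]=⇒lookup (Subset.x∉p⇒x∈∁p c∉P)))

-- Configurations

multisets : ∀ nⁱ → Resource (List (Token nⁱ))
multisets nⁱ = Multiset-resource
  {_≤ᵀ_ = _≤ᴵ_} (λ _ → ⊴-refl) (λ p q c → ⊴-trans (p c) (q c)) _≤ᴵ?_ AF-≤ᴵ
  size (λ {m} {m′} le → Resource.weight-mono (tokens nⁱ) {m} {m′} (≤ᴵ⇒Pointwise-≤ le)) ≤ᴵ-tight
  (Resource.enumerate (tokens nⁱ)) (Resource.enumerate-∈ (tokens nⁱ))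

configs : ∀ nˢ nᶜ nⁱ → Resource (Config nˢ nᶜ nⁱ)
configs nˢ nᶜ nⁱ = record
  { _≈_ = Defs._≈_
  ; _≼_ = λ s t → (simple s S.≼ simple t) × (complex s C.≼ complex t)
  ; _⊑_ = λ s t → (simple s S.⊑ simple t) × (complex s C.⊑ complex t)
  ; _∙_ = _⊕_
  ; weight = λ s → S.weight (simple s) + C.weight (complex s)
  ; enumerate = λ k → cartesianProductWith config (S.enumerate k) (C.enumerate k)
  ; ≈-isEquivalence = record
    { refl  = refl , C.≈-refl
    ; sym   = λ (e , f) → sym e , C.≈-sym f
    ; trans = λ (e , f) (e′ , f′) → trans e e′ , C.≈-trans f f′
    }
  ; ∙-cong = λ (e , f) (e′ , f′) → cong₂ _⊕ₜ_ e e′ , C.∙-cong f f′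
  ; ∙-comm = λ s t →
      Vecᴾ.Pointwise-≡⇒≡ (S.∙-comm (simple s) (simple t)) , C.∙-comm (complex s) (complex t)
  ; ≼-reflexive = λ (e , f) → S.≼-reflexive (Vecᴾ.≡⇒Pointwise-≡ e) , C.≼-reflexive f
  ; ≼-trans = λ (p , q) (p′ , q′) → S.≼-trans p p′ , C.≼-trans q q′
  ; ∙-mono = λ (p , q) (p′ , q′) → S.∙-mono p p′ , C.∙-mono q q′
  ; _≼?_ = λ s t → (simple s S.≼? simple t) ×-dec (complex s C.≼? complex t)
  ; ≼-AF = AF-map (λ s → simple s , complex s) (λ _ _ r → r) (AF-× S.≼-AF C.≼-AF)
  ; ∙-splitˡ = λ s t (p , q) →
      let _ , _ , p₁ , p₂ , e = S.∙-splitˡ (simple s) (simple t) p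
          _ , _ , q₁ , q₂ , f = C.∙-splitˡ (complex s) (complex t) q
      in config _ _ , config _ _ , (p₁ , q₁) , (p₂ , q₂) , (Vecᴾ.Pointwise-≡⇒≡ e , f)
  ; ≼-∙-split = λ t a b (p , q) →
      let _ , p₁ , le₁ , p₂ = S.≼-∙-split (simple t) (simple a) (simple b) p
          _ , q₁ , le₂ , q₂ = C.≼-∙-split (complex t) (complex a) (complex b) q
      in config _ _ , (p₁ , q₁) , +-mono-≤ le₁ le₂ , (p₂ , q₂)
  ; weight-∙ = λ s t → trans
      (cong₂ _+_ (S.weight-∙ (simple s) (simple t)) (C.weight-∙ (complex s) (complex t)))
      (interchange +-commutativeSemigroup (S.weight (simple s)) (S.weight (simple t))
                   (C.weight (complex s)) (C.weight (complex t)))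
  ; weight-mono = λ (p , q) → +-mono-≤ (S.weight-mono p) (C.weight-mono q)
  ; weight-tight = λ (p , q) le →
      let le₁ , le₂ = squeeze (S.weight-mono p) (C.weight-mono q) le
      in Vecᴾ.Pointwise-≡⇒≡ (S.weight-tight p le₁) , C.weight-tight q le₂
  ; enumerate-∈ = λ k s le → ∈-cartesianProductWith⁺ config
      (S.enumerate-∈ k (simple s) (m+n≤o⇒m≤o _ le))
      (C.enumerate-∈ k (complex s) (m+n≤o⇒n≤o (S.weight (simple s)) le))
  }
  where
  module S = Resource (tokens nˢ)
  module C = Resource (Vec-resource (multisets nⁱ) nᶜ)

-- Injections on positions and embeddings

removable : ∀ {A : Set} {xs ys : List A} → Unique xs → (∀ {x} → x ∈ xs → x ∈ ys) →
            ∃ λ zs → ys ↭ xs ++ zs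
removable {xs = []}     []       sub = _ , ↭-refl
removable {xs = x ∷ xs} (x∉ ∷ u) sub with ∈-removable (sub (here refl))
... | ys′ , e with removable {ys = ys′} u still
  where
  still : ∀ {y} → y ∈ xs → y ∈ ys′
  still y∈xs with ∈-resp-↭ e (sub (there y∈xs))
  ... | here refl   = ⊥-elim (All.lookup x∉ y∈xs refl)
  ... | there y∈ys′ = y∈ys′
... | zs , f = zs , ↭-trans e (prep x f)

module _ {T : Set} {_≤ᵀ_ : Rel T 0ℓ} where

  MultisetExt⇒Embedding : ∀ {M N} → MultisetExt _≤ᵀ_ M N → Embedding _≤ᵀ_ M N
  MultisetExt⇒Embedding {M} {N} (f , le)
    -- The values of an injection are distinct positions, so the list of all positions is a
    -- permutation of these values followed by the rest; looking up entries turns this into the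
    -- partition of `N`.
    with removable {xs = List.tabulate (Injection.to f)} {List.allFin (length N)}
           (Unique.tabulate⁺ (Injection.injective f)) (λ _ → ∈-allFin _)
  ... | rest , e = embed {image = image}
    (subst (λ M → Listᴾ.Pointwise _≤ᵀ_ M image) (tabulate-lookup M) (Listᴾ.tabulate⁺ le))
    (subst₂ _↭_
      (trans (map-tabulate (λ i → i) (List.lookup N)) (tabulate-lookup N))
      (trans (map-++ (List.lookup N) _ rest)
        (cong (_++ List.map (List.lookup N) rest) (map-tabulate (Injection.to f) (List.lookup N))))
      (map⁺ (List.lookup N) e))
    where image = List.tabulate (λ i → List.lookup N (Injection.to f i))

  Pointwise⇒MultisetExt : ∀ {M zs} ws → Listᴾ.Pointwise _≤ᵀ_ M zs → MultisetExt _≤ᵀ_ M (zs ++ ws)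
  Pointwise⇒MultisetExt ws []       = mk↣ {to = λ ()} (λ { {()} }) , λ ()
  Pointwise⇒MultisetExt ws (_∷_ {xs = M} {ys = zs} r rs) with Pointwise⇒MultisetExt ws rs
  ... | f , le = mk↣ {to = to} inj , λ where
      zero    → r
      (suc i) → le i
    where
    to : Fin (suc (length M)) → Fin (suc (length (zs ++ ws)))
    to zero    = zero
    to (suc i) = suc (Injection.to f i)
    inj : ∀ {i j} → to i ≡ to j → i ≡ j
    inj {zero}  {zero}  e = refl
    inj {suc i} {suc j} e = cong suc (Injection.injective f (Fin.suc-injective e))

  Embedding⇒MultisetExt : ∀ {M N} → Embedding _≤ᵀ_ M N → MultisetExt _≤ᵀ_ M N
  Embedding⇒MultisetExt {M} {N} (embed {image} {rest} p q) with Pointwise⇒MultisetExt rest p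
  ... | f , le = Inverse⇒Injection σ ↣-∘ f , λ i →
      subst (_ ≤ᵀ_) (↭ₛ.onIndices-lookup (setoid T) q′ (Injection.to f i)) (le i)
    where
    q′ = ↭⇒↭ₛ (↭-sym q)
    σ = Homogeneous.onIndices q′

module _ {nˢ nᶜ nⁱ : ℕ} where
  open Resource (configs nˢ nᶜ nⁱ)

  ≤ᶜ⇒≼ : ∀ {s t} → s ≤ᶜ t → s ≼ t
  ≤ᶜ⇒≼ (p , q) = pointwise p , pointwise (λ i → MultisetExt⇒Embedding (q i))

  ≼⇒≤ᶜ : ∀ {s t} → s ≼ t → s ≤ᶜ t
  ≼⇒≤ᶜ (p , q) = Vecᴾ.lookup p , λ i → Embedding⇒MultisetExt (Vecᴾ.lookup q i)

-- Firing rules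

-- For a target of weight `k`: the first summand bounds the bystanders that are kept, the second the
-- size of a truncated token.
preBound : ℕ → ℕ → ℕ
preBound nⁱ k = k + nⁱ * suc k

[_↦_] : Fin nᶜ → Token nⁱ → Vec (List (Token nⁱ)) nᶜ
[ p ↦ m ] = replicate _ [] [ p ]≔ [ m ]

module _ {nˢ nᶜ nⁱ : ℕ} where
  open Resource (configs nˢ nᶜ nⁱ)
  private
    module S = Resource (tokens nˢ)
    module M = Resource (multisets nⁱ)
    module C {n} = Resource (Vec-resource (multisets nⁱ) n)

  weight-empty : ∀ n → C.weight {n} (replicate n []) ≡ 0
  weight-empty zero    = refl
  weight-empty (suc n) = weight-empty n

  weight-singleton : ∀ {n} (p : Fin n) m → C.weight [ p ↦ m ] ≡ suc (size m)
  weight-singleton {suc n} zero m =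
    trans (cong₂ _+_ (+-identityʳ _) (weight-empty n)) (+-identityʳ _)
  weight-singleton (suc p) m = weight-singleton p m

  weight-⟦↦⟧ : ∀ (p : Fin nᶜ) (m : Token nⁱ) → weight ⟦ p ↦ m ⟧ ≡ suc (size m)
  weight-⟦↦⟧ p m = cong₂ _+_ (size-𝟎 nˢ) (weight-singleton p m)

  weight-onlySimple : ∀ v → weight (onlySimple v) ≡ size v
  weight-onlySimple v = trans (cong (size v +_) (weight-empty nᶜ)) (+-identityʳ _)

  ⟦↦⟧-mono : ∀ p (m m′ : Token nⁱ) → m ≤ᴵ m′ → ⟦ p ↦ m ⟧ ≼ ⟦ p ↦ m′ ⟧
  ⟦↦⟧-mono p m m′ le = S.≼-refl , go p
    where
    go : ∀ {n} (p : Fin n) → [ p ↦ m ] C.≼ [ p ↦ m′ ]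
    go zero    = cons le []-embeds ∷ C.≼-refl
    go (suc p) = M.≼-refl ∷ go p

  onlySimple-mono : ∀ {v v′} → Pointwise _≤_ v v′ → onlySimple v ≼ onlySimple v′
  onlySimple-mono le = le , C.≼-refl

  ⟦↦⟧-⊑ : ∀ p {m : Token nⁱ} {s} → ⟦ p ↦ m ⟧ ⊑ s → ∃ λ m′ → m ≤ᴵ m′ × s ≡ ⟦ p ↦ m′ ⟧
  ⟦↦⟧-⊑ p {m} (e , f) with go p f
    where
    empty : ∀ {n v} → replicate n [] C.⊑ v → v ≡ replicate n []
    empty {zero}  []       = refl
    empty {suc n} ([] ∷ f) = cong ([] ∷_) (empty f)

    go : ∀ {n v} (p : Fin n) → [ p ↦ m ] C.⊑ v → ∃ λ m′ → m ≤ᴵ m′ × v ≡ [ p ↦ m′ ]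
    go zero    ((le ∷ []) ∷ f) = _ , le , cong (_ ∷_) (empty f)
    go (suc p) ([] ∷ f) with go p f
    ... | _ , le , g = _ , le , cong ([] ∷_) g
  ... | _ , le , g = _ , le , cong₂ config (sym (Vecᴾ.Pointwise-≡⇒≡ e)) g

  ZeroTokens : Config nˢ nᶜ nⁱ → Set
  ZeroTokens s = ∀ p {m} → m ∈ lookup (complex s) p → m ≡ 𝟎

  -- Under `⊑` simple places are fixed and no complex token is added, and an empty token has nothing
  -- above it but itself.
  ⊑-rigid : ∀ s {t} → ZeroTokens s → s ⊑ t → s ≡ t
  ⊑-rigid s zeros (e , f) = cong₂ config (Vecᴾ.Pointwise-≡⇒≡ e)
    (Vecᴾ.Pointwise-≡⇒≡ (pointwise λ p → list (zeros p) (Vecᴾ.lookup f p)))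
    where
    list : ∀ {M N : List (Token nⁱ)} → (∀ {m} → m ∈ M → m ≡ 𝟎) → Listᴾ.Pointwise _≤ᴵ_ M N → M ≡ N
    list zeros []       = refl
    list zeros (le ∷ p) with zeros (here refl)
    ... | refl = cong₂ _∷_ (𝟎≤ᴵ⇒≡ le) (list (λ m∈M → zeros (there m∈M)) p)

  InConfigₛ⇒ZeroTokens : ∀ s → InConfigₛ s → ZeroTokens s
  InConfigₛ⇒ZeroTokens s empty p m∈ with subst (_ ∈_) (empty p) m∈
  ... | ()

  -- Allows a token to be truncated inside a sum: the replacement need not dominate the original,
  -- only cover the same light targets.
  CoversUpTo : ℕ → Rel (Config nˢ nᶜ nⁱ) 0ℓ
  CoversUpTo k s s′ = ∀ {t} → weight t ≤ k → t ≼ s → t ≼ s′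

  coversUpTo-∙ˡ : ∀ {k a a′ b} → CoversUpTo k a a′ → CoversUpTo k (a ∙ b) (a′ ∙ b)
  coversUpTo-∙ˡ {a = a} {b = b} f {t} t≤k t≼ with ≼-∙-split t a b t≼
  ... | t₀ , t₀≼a , le , t≼′ = ≼-trans t≼′ (∙-mono (f (≤-trans le t≤k) t₀≼a) ≼-refl)

  coversUpTo-∙ : ∀ {k a a′ b b′} → CoversUpTo k a a′ → CoversUpTo k b b′ → CoversUpTo k (a ∙ b) (a′ ∙ b′)
  coversUpTo-∙ {a = a} {a′} {b} {b′} f g t≤k t≼ =
    -- The summands are replaced one at a time, each brought to the left by commutativity.
    ≼-trans (coversUpTo-∙ˡ g t≤k (≼-trans (coversUpTo-∙ˡ f t≤k t≼) (≼-reflexive (∙-comm a′ b))))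
            (≼-reflexive (∙-comm b′ a′))

  coversUpTo-⟦↦⟧ : ∀ {k} p {m m′ : Token nⁱ} → (∀ {σ} → size σ ≤ k → σ ≤ᴵ m → σ ≤ᴵ m′) →
                CoversUpTo k ⟦ p ↦ m ⟧ ⟦ p ↦ m′ ⟧
  coversUpTo-⟦↦⟧ {k} p {m} {m′} f {t} t≤k (le , e) =
    le , go p (m+n≤o⇒n≤o (S.weight (simple t)) t≤k) e
    where
    single : ∀ {N} → M.weight N ≤ k → N M.≼ [ m ] → N M.≼ [ m′ ]
    single {[]}    N≤k e = []-embeds
    single {σ ∷ N} N≤k e with uncons e
    ... | _ , _ , le , g , e′ with ↭-singleton-inv (↭-sym g)
    ... | refl = cons (f {σ} (≤-trans (n≤1+n (size σ)) (m+n≤o⇒m≤o (suc (size σ)) N≤k)) le) e′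

    go : ∀ {n v} (p : Fin n) → C.weight v ≤ k → v C.≼ [ p ↦ m ] → v C.≼ [ p ↦ m′ ]
    go zero    v≤k (e ∷ es) = single (m+n≤o⇒m≤o _ v≤k) e ∷ es
    go (suc p) v≤k (_∷_ {x = N} e es) = e ∷ go p (m+n≤o⇒n≤o (M.weight N) v≤k) es

  coversUpTo-onlySimple : ∀ {k v v′} →
    (∀ {u} → size u ≤ k → Pointwise _≤_ u v → Pointwise _≤_ u v′) →
    CoversUpTo k (onlySimple v) (onlySimple v′)
  coversUpTo-onlySimple f t≤k (le , e) = f (m+n≤o⇒m≤o _ t≤k) le , e

module _ {nˢ nᶜ nⁱ : ℕ} {ζ : Fin nⁱ → Fin nˢ} where
  open Resource (configs nˢ nᶜ nⁱ)

  -- The configuration s₀ and the token m of a firing; simple rules ignore m.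
  Instance : Set
  Instance = Config nˢ nᶜ nⁱ × Token nⁱ

  infix 4 _≤ⁱ_

  _≤ⁱ_ : Rel Instance 0ℓ
  (s , m) ≤ⁱ (s′ , m′) = s ≼ s′ × m ≤ᴵ m′

  ejection : Subset nⁱ → Token nⁱ → Config nˢ nᶜ nⁱ
  ejection P m = onlySimple (eject ζ P m)

  ejection-mono : ∀ P m m′ → m ≤ᴵ m′ → ejection P m ≼ ejection P m′
  ejection-mono P m m′ q = onlySimple-mono (eject-mono ζ P m m′ q)

  pre post : Rule nˢ nᶜ nⁱ ζ → Instance → Config nˢ nᶜ nⁱ
  pre (simpleRule I _ _)             (s , m) = s ⊕ I
  pre (complexRule p I _ _ _ _ _)    (s , m) = s ⊕ I ⊕ ⟦ p ↦ m ⟧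
  pre (transferRule p I _ _ _ _ _ _) (s , m) = s ⊕ I ⊕ ⟦ p ↦ m ⟧
  post (simpleRule _ O _)              (s , m) = s ⊕ O
  post (complexRule _ _ p′ 𝔠 O _ _)    (s , m) = s ⊕ O ⊕ ⟦ p′ ↦ m ⊕ₜ 𝔠 ⟧
  post (transferRule _ _ p′ P O _ _ _) (s , m) =
    s ⊕ O ⊕ ejection P m ⊕ ⟦ p′ ↦ m ↾ ∁ P ⟧

  fire : ∀ r i {s t} → s ≈ pre r i → t ≈ post r i → Fires r s t
  fire (simpleRule _ _ _)             (s₀ , m) e f = s₀ , e , f
  fire (complexRule _ _ _ _ _ _ _)    (s₀ , m) e f = s₀ , m , e , f
  fire (transferRule _ _ _ _ _ _ _ _) (s₀ , m) e f = s₀ , m , e , f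

  private
    ≤-∙ˡ : ∀ a b → weight a ≤ weight (a ∙ b)
    ≤-∙ˡ a b = ≤-trans (m≤m+n (weight a) (weight b)) (≤-reflexive (sym (weight-∙ a b)))

    ≤-∙ʳ : ∀ a b → weight b ≤ weight (a ∙ b)
    ≤-∙ʳ a b = ≤-trans (m≤n+m (weight b) (weight a)) (≤-reflexive (sym (weight-∙ a b)))

    size≤ : ∀ p m → size m ≤ weight ⟦ p ↦ m ⟧
    size≤ p m = ≤-trans (n≤1+n _) (≤-reflexive (sym (weight-⟦↦⟧ {nˢ} p m)))

    bounds : ∀ s₀ I p m {s} → s ≈ s₀ ⊕ I ⊕ ⟦ p ↦ m ⟧ → weight s₀ ≤ weight s × size m ≤ weight s
    bounds s₀ I p m e rewrite weight-≈ e =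
      ≤-trans (≤-∙ˡ s₀ I) (≤-∙ˡ (s₀ ⊕ I) ⟦ p ↦ m ⟧) ,
      ≤-trans (size≤ p m) (≤-∙ʳ (s₀ ⊕ I) ⟦ p ↦ m ⟧)

  unfire : ∀ r {s t} → Fires r s t →
           ∃ λ i → s ≈ pre r i × t ≈ post r i × weight (proj₁ i) ≤ weight s × size (proj₂ i) ≤ weight s
  -- The placeholder token `𝟎` has size zero and meets every bound.
  unfire (simpleRule I _ _) {s} (s₀ , e , f) = (s₀ , 𝟎) , e , f ,
    ≤-trans (≤-∙ˡ s₀ I) (≤-reflexive (sym (weight-≈ e))) , subst (_≤ weight s) (sym (size-𝟎 nⁱ)) z≤n
  unfire (complexRule p I _ _ _ _ _)    (s₀ , m , e , f) = (s₀ , m) , e , f , bounds s₀ I p m e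
  unfire (transferRule p I _ _ _ _ _ _) (s₀ , m , e , f) = (s₀ , m) , e , f , bounds s₀ I p m e

  pre-mono : ∀ r {i j} → i ≤ⁱ j → pre r i ≼ pre r j
  pre-mono (simpleRule _ _ _)             (p , q) = ∙-mono p ≼-refl
  pre-mono (complexRule x _ _ _ _ _ _)    {_ , m} {_ , m′} (p , q) =
    ∙-mono (∙-mono p ≼-refl) (⟦↦⟧-mono x m m′ q)
  pre-mono (transferRule x _ _ _ _ _ _ _) {_ , m} {_ , m′} (p , q) =
    ∙-mono (∙-mono p ≼-refl) (⟦↦⟧-mono x m m′ q)

  post-mono : ∀ r {i j} → i ≤ⁱ j → post r i ≼ post r j
  post-mono (simpleRule _ _ _)              (p , q) = ∙-mono p ≼-refl
  post-mono (complexRule _ _ p′ 𝔠 _ _ _)    {_ , m} {_ , m′} (p , q) =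
    ∙-mono (∙-mono p ≼-refl) (⟦↦⟧-mono p′ (m ⊕ₜ 𝔠) (m′ ⊕ₜ 𝔠) (⊕ₜ-mono m m′ 𝔠 q))
  post-mono (transferRule _ _ p′ P _ _ _ _) {_ , m} {_ , m′} (p , q) =
    ∙-mono (∙-mono (∙-mono p ≼-refl) (ejection-mono P m m′ q))
           (⟦↦⟧-mono p′ (m ↾ ∁ P) (m′ ↾ ∁ P) (↾-mono (∁ P) m m′ q))

  private
    lift-simple : ∀ I {s u} → ZeroTokens I → s ⊕ I ≼ u → ∃ λ s′ → s ≼ s′ × u ≈ s′ ⊕ I
    lift-simple I {s} zeros s⊕I≼u with ∙-splitˡ s I s⊕I≼u
    ... | s′ , I′ , p , q , e with ⊑-rigid I zeros q
    ... | refl = s′ , p , e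

    lift-complex : ∀ p I {s m u} → InConfigₛ I → s ⊕ I ⊕ ⟦ p ↦ m ⟧ ≼ u →
                   ∃ λ j → (s , m) ≤ⁱ j × u ≈ proj₁ j ⊕ I ⊕ ⟦ p ↦ proj₂ j ⟧
    lift-complex p I {s} {m} empty le with ∙-splitˡ (s ⊕ I) ⟦ p ↦ m ⟧ le
    ... | a , b , q , r , e with ⟦↦⟧-⊑ p r | lift-simple I (InConfigₛ⇒ZeroTokens I empty) q
    ... | m′ , m≤m′ , refl | s′ , s≼s′ , f =
      (s′ , m′) , (s≼s′ , m≤m′) , ≈-trans e (∙-cong f ≈-refl)

  -- The surplus of `u` goes to the bystanders and to the chosen complex token; the remaining input
  -- of the rule is rigid.
  lift : ∀ r {i u} → pre r i ≼ u → ∃ λ j → i ≤ⁱ j × u ≈ pre r j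
  lift (simpleRule I _ only𝟎) {s , m} le
    -- The rule only forbids nonempty tokens in `I`; decidable equality turns this into equality
    -- with `𝟎`.
    with lift-simple I (λ p {m} m∈I → decidable-stable (≡-dec _≟_ m 𝟎) λ m≢𝟎 → only𝟎 p m m≢𝟎 m∈I) le
  ... | s′ , s≼s′ , e = (s′ , m) , (s≼s′ , λ _ → ⊴-refl) , e
  lift (complexRule p I _ _ _ empty _)    le = lift-complex p I empty le
  lift (transferRule p I _ _ _ empty _ _) le = lift-complex p I empty le

  private
    squeeze-∙ : ∀ a b c d → a ≼ c → b ≼ d → weight (c ∙ d) ≤ weight (a ∙ b) →
                weight c ≤ weight a × weight d ≤ weight b
    squeeze-∙ a b c d p q le = squeeze (weight-mono {a} {c} p) (weight-mono {b} {d} q)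
      (subst₂ _≤_ (weight-∙ c d) (weight-∙ a b) le)

    weight-≤-∙ : ∀ a b c d → weight a ≤ weight c → weight b ≤ weight d → weight (a ∙ b) ≤ weight (c ∙ d)
    weight-≤-∙ a b c d p q = subst₂ _≤_ (sym (weight-∙ a b)) (sym (weight-∙ c d)) (+-mono-≤ p q)

    weight-pre : ∀ I p s s′ m m′ → weight s ≤ weight s′ → size m ≤ size m′ →
                 weight (s ⊕ I ⊕ ⟦ p ↦ m ⟧) ≤ weight (s′ ⊕ I ⊕ ⟦ p ↦ m′ ⟧)
    weight-pre I p s s′ m m′ le le′ = weight-≤-∙ (s ⊕ I) ⟦ p ↦ m ⟧ (s′ ⊕ I) ⟦ p ↦ m′ ⟧
      (weight-≤-∙ s I s′ I le ≤-refl)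
      (subst₂ _≤_ (sym (weight-⟦↦⟧ {nˢ} p m)) (sym (weight-⟦↦⟧ {nˢ} p m′)) (s≤s le′))

    size≤⁻ : ∀ p m m′ → weight ⟦ p ↦ m ⟧ ≤ weight ⟦ p ↦ m′ ⟧ → size m ≤ size m′
    size≤⁻ p m m′ le = ≤-pred (subst₂ _≤_ (weight-⟦↦⟧ {nˢ} p m) (weight-⟦↦⟧ {nˢ} p m′) le)

  -- Firing never makes a strictly larger configuration catch up with a smaller one: a transfer
  -- loses nothing, because ζ is injective on the ejected colours.
  weight-reflect : ∀ r {i j} → i ≤ⁱ j → weight (post r j) ≤ weight (post r i) →
                   weight (pre r j) ≤ weight (pre r i)
  weight-reflect (simpleRule I O _) {s , _} {s′ , _} (p , q) le =
    weight-≤-∙ s′ I s I (proj₁ (squeeze-∙ s O s′ O p ≼-refl le)) ≤-refl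
  weight-reflect (complexRule x I p′ 𝔠 O _ _) {s , m} {s′ , m′} (p , q) le
    with squeeze-∙ (s ⊕ O) ⟦ p′ ↦ m ⊕ₜ 𝔠 ⟧ (s′ ⊕ O) ⟦ p′ ↦ m′ ⊕ₜ 𝔠 ⟧ (∙-mono p ≼-refl)
                   (⟦↦⟧-mono p′ (m ⊕ₜ 𝔠) (m′ ⊕ₜ 𝔠) (⊕ₜ-mono m m′ 𝔠 q)) le
  ... | le₁ , le₂ = weight-pre I x s′ s m′ m (proj₁ (squeeze-∙ s O s′ O p ≼-refl le₁))
    (+-cancelʳ-≤ (size 𝔠) (size m′) (size m) (subst₂ _≤_ (T.weight-∙ m′ 𝔠) (T.weight-∙ m 𝔠)
      (size≤⁻ p′ (m′ ⊕ₜ 𝔠) (m ⊕ₜ 𝔠) le₂)))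
    where module T = Resource (tokens nⁱ)
  weight-reflect (transferRule x I p′ P O _ _ inj) {s , m} {s′ , m′} (p , q) le
    with squeeze-∙ (s ⊕ O ⊕ ejection P m) ⟦ p′ ↦ m ↾ ∁ P ⟧ (s′ ⊕ O ⊕ ejection P m′) ⟦ p′ ↦ m′ ↾ ∁ P ⟧
                   (∙-mono (∙-mono p ≼-refl) (ejection-mono P m m′ q))
                   (⟦↦⟧-mono p′ (m ↾ ∁ P) (m′ ↾ ∁ P) (↾-mono (∁ P) m m′ q)) le
  ... | le₁ , kept with squeeze-∙ (s ⊕ O) (ejection P m) (s′ ⊕ O) (ejection P m′) (∙-mono p ≼-refl)
                                (ejection-mono P m m′ q) le₁
  ... | le₂ , ejected = weight-pre I x s′ s m′ m (proj₁ (squeeze-∙ s O s′ O p ≼-refl le₂))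
    (≤-reflexive (cong size (sym m≡m′)))
    where
    -- Neither the ejected nor the kept part has gained weight, so both are equal, and together they
    -- determine the token.
    m≡m′ : m ≡ m′
    m≡m′ = transfer-injective ζ P inj
      (Vecᴾ.Pointwise-≡⇒≡ (Resource.weight-tight (tokens nˢ) (eject-mono ζ P m m′ q)
        (subst₂ _≤_ (weight-onlySimple {nˢ} {nᶜ} {nⁱ} (eject ζ P m′))
                    (weight-onlySimple {nˢ} {nᶜ} {nⁱ} (eject ζ P m)) ejected)))
      (≤ᴵ-tight (↾-mono (∁ P) m m′ q) (size≤⁻ p′ (m′ ↾ ∁ P) (m ↾ ∁ P) kept))

  private
    -- The produced summands are peeled off one by one, leaving a part of `t` that selects `s′` from
    -- `s`. Then the summands that depend on the token are replaced by truncated versions, which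
    -- cover `t` equally well.
    shrink : ∀ r {t s m} → t ≼ post r (s , m) →
             ∃ λ s′ → s′ ≼ s × weight s′ ≤ weight t × t ≼ post r (s′ , truncate (weight t) m)
    shrink (simpleRule _ O _) {t} {s} t≼ = ≼-∙-split t s O t≼
    shrink (complexRule _ _ p′ 𝔠 O _ _) {t} {s} {m} t≼
      with ≼-∙-split t (s ⊕ O) ⟦ p′ ↦ m ⊕ₜ 𝔠 ⟧ t≼
    ... | t₁ , t₁≼ , le₁ , t≼₁ with ≼-∙-split t₁ s O t₁≼
    ... | s′ , s′≼s , le₀ , t₁≼′ = s′ , s′≼s , ≤-trans le₀ le₁ ,
      coversUpTo-∙ (λ _ u → u) (coversUpTo-⟦↦⟧ p′ (λ {σ} → ⊕ₜ-truncate {σ = σ} {m} 𝔠)) ≤-refl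
        (≼-trans t≼₁ (∙-mono t₁≼′ ≼-refl))
    shrink (transferRule _ _ p′ P O _ _ _) {t} {s} {m} t≼
      with ≼-∙-split t (s ⊕ O ⊕ ejection P m) ⟦ p′ ↦ m ↾ ∁ P ⟧ t≼
    ... | t₁ , t₁≼ , le₁ , t≼₁ with ≼-∙-split t₁ (s ⊕ O) (ejection P m) t₁≼
    ... | t₂ , t₂≼ , le₂ , t₁≼₂ with ≼-∙-split t₂ s O t₂≼
    ... | s′ , s′≼s , le₀ , t₂≼′ = s′ , s′≼s , ≤-trans le₀ (≤-trans le₂ le₁) ,
      coversUpTo-∙ (coversUpTo-∙ (λ _ u → u) (coversUpTo-onlySimple (eject-truncate ζ P)))
        (coversUpTo-⟦↦⟧ p′ (λ {σ} → ↾-truncate (∁ P) {σ = σ} {m})) ≤-refl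
        (≼-trans t≼₁ (∙-mono (≼-trans t₁≼₂ (∙-mono t₂≼′ ≼-refl)) ≼-refl))

  small-instance : ∀ r {t i} → t ≼ post r i →
    ∃ λ j → j ≤ⁱ i × t ≼ post r j ×
            weight (proj₁ j) ≤ preBound nⁱ (weight t) × size (proj₂ j) ≤ preBound nⁱ (weight t)
  small-instance r {t} {s , m} t≼ with shrink r t≼
  ... | s′ , s′≼s , le , t≼′ = (s′ , truncate (weight t) m) , (s′≼s , truncate-≤ᴵ (weight t) m) , t≼′ ,
    m≤n⇒m≤n+o _ le , m≤n⇒m≤o+n _ (size-truncate (weight t) m)

-- Well-structured transition systems

any-∈? : ∀ {A : Set} {P : A → Set} xs → (∀ {x} → x ∈ xs → Dec (P x)) → Dec (Any P xs)
any-∈? []       P? = no λ ()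
any-∈? (x ∷ xs) P? = map′ Any.fromSum Any.toSum (P? (here refl) ⊎-dec any-∈? xs (λ x∈ → P? (there x∈)))

record WellStructured {X : Set} (𝓡 : Resource X) : Set₁ where
  open Resource 𝓡
  infix 4 _⟶_
  field
    _⟶_                   : Rel X 0ℓ
    ⟶-resp                : ∀ {s s′ t t′} → s ≈ s′ → t ≈ t′ → s ⟶ t → s′ ⟶ t′
    successors            : X → List X
    successors-sound      : ∀ {s t} → t ∈ successors s → s ⟶ t
    successors-complete   : ∀ {s t} → s ⟶ t → Any (t ≈_) (successors s)
    -- A finite basis: the configurations above a member of `predecessors t` are those that can step
    -- to something above `t`.
    predecessors          : X → List X
    predecessors-sound    : ∀ {t b} → b ∈ predecessors t → ∃ λ t′ → b ⟶ t′ × t ≼ t′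
    predecessors-complete : ∀ {u t t′} → u ⟶ t′ → t ≼ t′ → Any (_≼ u) (predecessors t)
    -- The last component is strict monotonicity in contrapositive form: if `u` is heavier than `s`,
    -- then `v` is heavier than `t`.
    simulate              : ∀ {s t u} → s ⟶ t → s ≼ u →
      ∃ λ v → u ⟶ v × t ≼ v × (weight v ≤ weight t → weight u ≤ weight s)

module Decision {X : Set} (𝓡 : Resource X) (𝓢 : WellStructured 𝓡) where
  open Resource 𝓡
  open WellStructured 𝓢

  -- No infinite bad sequence extends the history h (latest element first).
  data Accessible (h : List X) : Set where
    acc : (∀ x → ¬ Any (_≼ x) h → Accessible (x ∷ h)) → Accessible h

  private
    Good : List X → Set
    Good []      = ⊥
    Good (x ∷ h) = Any (_≼ x) h ⊎ Good h

    -- The invariant is that `R y z` produces a good pair once `y` and `z` are appended to `h`.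
    -- Passing to the residual at `x` matches pushing `x` onto the history.
    AF⇒Accessible : ∀ {R : Rel X 0ℓ} h → ¬ Good h → (∀ y z → R y z → Good (z ∷ y ∷ h)) →
                    AF R → Accessible h
    AF⇒Accessible h bad f (now r) = acc λ y ¬y → acc λ z ¬z →
      ⊥-elim ([ ¬z , [ ¬y , bad ]′ ]′ (f y z (r y z)))
    AF⇒Accessible h bad f (later p) = acc λ x ¬x → AF⇒Accessible (x ∷ h) [ ¬x , bad ]′
      (λ where
        y z (inj₂ r) → inj₂ (f x y r)
        y z (inj₁ r) → insert (f y z r))
      (p x)
      where
      insert : ∀ {x y z} → Good (z ∷ y ∷ h) → Good (z ∷ y ∷ x ∷ h)
      insert (inj₁ (here r))  = inj₁ (here r)
      insert (inj₁ (there a)) = inj₁ (there (there a))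
      insert (inj₂ (inj₁ a))  = inj₂ (inj₁ (there a))
      insert (inj₂ (inj₂ g))  = inj₂ (inj₂ (inj₂ g))

  accessible : Accessible []
  accessible = AF⇒Accessible [] (λ ()) (λ y z r → inj₁ (here r)) ≼-AF

  -- Infinite paths

  infix 4 _⟶⁺_
  _⟶⁺_ : Rel X 0ℓ
  s ⟶⁺ t = ∃ λ s′ → s ⟶ s′ × Star _⟶_ s′ t

  snoc : ∀ {s t u} → s ⟶⁺ t → t ⟶ u → s ⟶⁺ u
  snoc (_ , x , xs) y = _ , x , xs ◅◅ y ◅ ε

  InfinitePath : X → Set
  InfinitePath s = Σ (ℕ → X) λ f → f zero ≈ s × (∀ n → f n ⟶ f (suc n))

  private
    infinite-∷ : ∀ {s t} → s ⟶ t → InfinitePath t → InfinitePath s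
    infinite-∷ {s} s⟶t (f , f0≈t , steps) = path , ≈-refl , λ where
        zero    → ⟶-resp ≈-refl (≈-sym f0≈t) s⟶t
        (suc n) → steps n
      where
      path : ℕ → X
      path zero    = s
      path (suc n) = f n

    infinite-uncons : ∀ {s} → InfinitePath s → ∃ λ t → s ⟶ t × InfinitePath t
    infinite-uncons (f , f0≈s , steps) =
      f 1 , ⟶-resp f0≈s ≈-refl (steps 0) , (λ n → f (suc n)) , ≈-refl , λ n → steps (suc n)

    infinite-resp : ∀ {s t} → s ≈ t → InfinitePath s → InfinitePath t
    infinite-resp s≈t (f , f0≈s , steps) = f , ≈-trans f0≈s s≈t , steps

  -- above imitates the path from a to s, which is restarted at a whenever s is reached.
  module Loop {a s : X} (a≼s : a ≼ s) (path : a ⟶⁺ s) where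
    record State : Set where
      constructor state
      field
        {above below} : X
        below≼above   : below ≼ above
        ahead         : below ⟶⁺ s
    open State

    next : (q : State) → ∃ λ q′ → above q ⟶ above q′
    next (state b≼u (b′ , b⟶b′ , rest)) with simulate b⟶b′ b≼u
    next (state b≼u (b′ , b⟶b′ , ε))      | u′ , u⟶u′ , b′≼u′ , _ =
      state (≼-trans a≼s b′≼u′) path , u⟶u′
    next (state b≼u (b′ , b⟶b′ , x ◅ xs)) | u′ , u⟶u′ , b′≼u′ , _ =
      state b′≼u′ (_ , x , xs) , u⟶u′

    states : ℕ → State
    states zero    = state a≼s path
    states (suc n) = proj₁ (next (states n))

    infinite : InfinitePath s
    infinite = (λ n → above (states n)) , ≈-refl , λ n → proj₂ (next (states n))

  infinitePath? : ∀ s → Dec (InfinitePath s)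
  infinitePath? s = search accessible s []
    where
    search : ∀ {h} → Accessible h → ∀ s → All (_⟶⁺ s) h → Dec (InfinitePath s)
    search {h} (acc rec) s paths with Any.any? (_≼? s) h
    ... | yes repeats = let a , a∈h , a≼s = ∈.find repeats
                        in yes (Loop.infinite a≼s (All.lookup paths a∈h))
    ... | no fresh = map′
      (λ found → let t , t∈ , inf = ∈.find found in infinite-∷ (successors-sound t∈) inf)
      (λ inf → let t , s⟶t , inf′ = infinite-uncons inf
               in Any.map (λ t≈t′ → infinite-resp t≈t′ inf′) (successors-complete s⟶t))
      -- Branching is finite, and each branch extends the history by the fresh `s`, so the recursion
      -- follows accessibility.
      (any-∈? (successors s) λ t∈ → search (rec s fresh) _
        ((_ , successors-sound t∈ , ε) ∷ All.map (λ path → snoc path (successors-sound t∈)) paths))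

  -- Finiteness of the reachable set

  Bounded Unbounded : X → Set
  Bounded s₀ = Σ (List X) λ ss → ∀ s → (∃ λ t → Star _⟶_ s₀ t × t ≈ s) ⇔ Any (s ≈_) ss
  Unbounded s₀ = ∀ n → ∃ λ s → Star _⟶_ s₀ s × n ≤ weight s

  private
    simulate* : ∀ {s t u} → Star _⟶_ s t → s ≼ u →
                ∃ λ v → Star _⟶_ u v × t ≼ v × (weight v ≤ weight t → weight u ≤ weight s)
    simulate* ε        s≼u = _ , ε , s≼u , λ le → le
    simulate* (x ◅ xs) s≼u with simulate x s≼u
    ... | v , u⟶v , t≼v , reflect with simulate* xs t≼v
    ... | v′ , path , t≼v′ , reflect′ = v′ , u⟶v ◅ path , t≼v′ , λ le → reflect (reflect′ le)

    pump : ∀ {s₀ a s} → Star _⟶_ s₀ a → Star _⟶_ a s → a ≼ s → weight a < weight s → Unbounded s₀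
    pump {s₀} s₀⟶a a⟶s a≼s lt n with pumped n
      where
      pumped : ∀ n → ∃₂ λ x y → Star _⟶_ s₀ x × Star _⟶_ x y × x ≼ y × weight x < weight y × n ≤ weight y
      pumped zero    = _ , _ , s₀⟶a , a⟶s , a≼s , lt , z≤n
      pumped (suc n) with pumped n
      ... | x , y , s₀⟶x , x⟶y , x≼y , x<y , n≤y with simulate* x⟶y x≼y
      ... | z , y⟶z , y≼z , reflect =
        y , z , s₀⟶x ◅◅ x⟶y , y⟶z , y≼z , y<z , ≤-<-trans n≤y y<z
        -- Otherwise, reflecting along the path from `x` to `y` would make `y` no heavier than `x`.
        where y<z = ≰⇒> λ z≤y → <⇒≱ x<y (reflect z≤y)
    ... | _ , y , s₀⟶x , x⟶y , _ , _ , n≤y = y , s₀⟶x ◅◅ x⟶y , n≤y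

    weight≤listWeight : ∀ {s} ss → Any (s ≈_) ss → weight s ≤ listWeight weight ss
    weight≤listWeight (t ∷ ss) (here s≈t) =
      ≤-trans (≤-reflexive (weight-≈ s≈t)) (≤-trans (n≤1+n _) (m≤m+n _ _))
    weight≤listWeight (t ∷ ss) (there a) = m≤n⇒m≤o+n (suc (weight t)) (weight≤listWeight ss a)

    unbounded⇒¬bounded : ∀ {s₀} → Unbounded s₀ → ¬ Bounded s₀
    unbounded⇒¬bounded unb (ss , f) with unb (suc (listWeight weight ss))
    ... | s , path , le = <⇒≱ le (weight≤listWeight ss (Equivalence.to (f s) (s , path , ≈-refl)))

  module _ (s₀ : X) where
    private
      -- `found` is closed only up to the history: a branch cut at an ancestor relies on that
      -- ancestor, which joins `found` when its own call returns.
      record Explored (h ts : List X) : Set where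
        constructor explored
        field
          found     : List X
          reachable : All (Star _⟶_ s₀) found
          closed    : ∀ {s t} → s ∈ found → s ⟶ t → Any (t ≈_) found ⊎ Any (t ≈_) h
          contains  : ∀ {t} → t ∈ ts → Any (t ≈_) found ⊎ Any (t ≈_) h

      explore-all : ∀ {h} ts → (∀ {t} → t ∈ ts → Unbounded s₀ ⊎ Explored h [ t ]) →
                    Unbounded s₀ ⊎ Explored h ts
      explore-all []       f = inj₂ (explored [] [] (λ ()) (λ ()))
      explore-all (t ∷ ts) f with f (here refl) | explore-all ts (λ t∈ → f (there t∈))
      ... | inj₁ unb | _        = inj₁ unb
      ... | inj₂ _   | inj₁ unb = inj₁ unb
      ... | inj₂ (explored L r c d) | inj₂ (explored L′ r′ c′ d′) = inj₂ (explored (L ++ L′)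
        (All.++⁺ r r′)
        (λ s∈ s⟶t → [ (λ s∈L  → Sum.map₁ Any.++⁺ˡ (c s∈L s⟶t))
                     , (λ s∈L′ → Sum.map₁ (Any.++⁺ʳ L) (c′ s∈L′ s⟶t)) ]′ (Any.++⁻ L s∈))
        (λ where
          (here e)   → Sum.map₁ Any.++⁺ˡ (d (here e))
          (there t∈) → Sum.map₁ (Any.++⁺ʳ L) (d′ t∈)))

      explore : ∀ {h} → Accessible h → ∀ s → Star _⟶_ s₀ s →
                All (λ a → Star _⟶_ s₀ a × Star _⟶_ a s) h → Unbounded s₀ ⊎ Explored h [ s ]
      explore {h} (acc rec) s s₀⟶s paths with Any.any? (_≼? s) h
      ... | yes repeats with ∈.find repeats
      ...   | a , a∈h , a≼s with weight s ≤? weight a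
      ...     | yes s≤a = inj₂ (explored [] [] (λ ()) λ where
                  (here refl) → inj₂ (∈.lose a∈h (≈-sym (weight-tight a≼s s≤a))))
      ...     | no s≰a = let s₀⟶a , a⟶s = All.lookup paths a∈h
                         in inj₁ (pump s₀⟶a a⟶s a≼s (≰⇒> s≰a))
      explore {h} (acc rec) s s₀⟶s paths
          | no fresh with explore-all (successors s) (λ t∈ → explore (rec s fresh) _
              (s₀⟶s ◅◅ successors-sound t∈ ◅ ε)
              ((s₀⟶s , successors-sound t∈ ◅ ε) ∷
               All.map (λ (p , q) → p , q ◅◅ successors-sound t∈ ◅ ε) paths))
      ...   | inj₁ unb = inj₁ unb
      ...   | inj₂ (explored L r c d) = inj₂ (explored (s ∷ L) (s₀⟶s ∷ r)
        (λ where
          (here refl) s⟶t → let t , t∈ , e = ∈.find (successors-complete s⟶t)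
                            in move (Sum.map (Any.map (≈-trans e)) (Any.map (≈-trans e)) (d t∈))
          (there s∈) s⟶t  → move (c s∈ s⟶t))
        (λ where (here refl) → inj₁ (here ≈-refl)))
        where
        move : ∀ {P : X → Set} → Any P L ⊎ Any P (s ∷ h) → Any P (s ∷ L) ⊎ Any P h
        move (inj₁ a)         = inj₁ (there a)
        move (inj₂ (here e))  = inj₁ (here e)
        move (inj₂ (there a)) = inj₂ a

    bounded? : Dec (Bounded s₀)
    bounded? with explore accessible s₀ ε []
    ... | inj₁ unb = no (unbounded⇒¬bounded unb)
    ... | inj₂ (explored L r c d) = yes (L , λ s → mk⇔
      (λ (t , path , t≈s) → Any.map (≈-trans (≈-sym t≈s)) (follow path (start (d (here refl)))))
      (λ a → let t , t∈ , e = ∈.find a in t , All.lookup r t∈ , ≈-sym e))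
      where
      -- At the root the history is empty, so `found` is closed outright.
      start : ∀ {P : X → Set} → Any P L ⊎ Any P [] → Any P L
      start (inj₁ a) = a

      follow : ∀ {s t} → Star _⟶_ s t → Any (s ≈_) L → Any (t ≈_) L
      follow ε        a = a
      follow (x ◅ xs) a = let s′ , s′∈ , e = ∈.find a
                          in follow xs (start (c s′∈ (⟶-resp e ≈-refl x)))

  -- Coverability by backward saturation

  Covers : X → X → Set
  Covers cov s = ∃ λ t → Star _⟶_ s t × cov ≼ t

  private
    covers-mono : ∀ {cov s u} → s ≼ u → Covers cov s → Covers cov u
    covers-mono s≼u (_ , path , c) with simulate* path s≼u
    ... | v , path′ , t≼v , _ = v , path′ , ≼-trans c t≼v

  covers? : ∀ cov s → Dec (Covers cov s)
  covers? cov s with accessible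
  ... | acc rec = saturate (rec cov λ ()) ((cov , ε , ≼-refl) ∷ []) (here ≼-refl)
    where
    -- The history doubles as the basis. Every member can cover `cov`, and some member lies below
    -- `cov`; a predecessor above no member extends the history while accessibility lasts.
    saturate : ∀ {h} → Accessible h → All (Covers cov) h → Any (_≼ cov) h → Dec (Covers cov s)
    saturate {h} (acc rec) covering cov∈h
      with any-∈? h (λ {t} _ → any-∈? (predecessors t) λ {b} _ → ¬? (Any.any? (_≼? b) h))
    ... | yes unsaturated =
      let t , t∈h , a  = ∈.find unsaturated
          b , b∈ , new = ∈.find a
          _ , b⟶t′ , t≼t′ = predecessors-sound b∈
          u , path , c = covers-mono t≼t′ (All.lookup covering t∈h)
      in saturate (rec b new) ((u , b⟶t′ ◅ path , c) ∷ covering) (there cov∈h)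
    ... | no saturated = map′
      (λ a → let _ , b∈ , b≼s = ∈.find a in covers-mono b≼s (All.lookup covering b∈))
      (λ (_ , path , c) → backwards path (Any.map (λ b≼cov → ≼-trans b≼cov c) cov∈h))
      (Any.any? (_≼? s) h)
      where
      -- When no predecessor is new, the upward closure of `h` is closed under stepping backwards,
      -- so it contains every configuration from which `cov` can be covered.
      backwards : ∀ {x y} → Star _⟶_ x y → Any (_≼ y) h → Any (_≼ x) h
      backwards ε        a = a
      backwards (x⟶z ◅ xs) a =
        let t , t∈h , t≼z = ∈.find (backwards xs a)
            b , b∈ , b≼x = ∈.find (predecessors-complete x⟶z t≼z)
        in Any.map (λ b′≼b → ≼-trans b′≼b b≼x)
             (decidable-stable (Any.any? (_≼? b) h) λ new → saturated (∈.lose t∈h (∈.lose b∈ new)))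

-- Nets

module Net (N : NNCT) where
  open NNCT N
  open Resource (configs #simple #complex #colours)

  instances : ℕ → List (Conf × Token #colours)
  instances k = cartesianProduct (enumerate k) (Resource.enumerate (tokens #colours) k)

  ∈-instances : ∀ {k s m} → weight s ≤ k → size m ≤ k → (s , m) ∈ instances k
  ∈-instances {k} {s} {m} le le′ = ∈-cartesianProduct⁺
    (enumerate-∈ k s le) (Resource.enumerate-∈ (tokens #colours) k m le′)

  results causes : Conf → Rule #simple #complex #colours ζ → List Conf
  results s r = map (post r) (filter (λ i → s ≈? pre r i) (instances (weight s)))
  causes t r = map (pre r) (filter (λ i → t ≼? post r i) (instances (preBound #colours (weight t))))

  successors predecessors : Conf → List Conf
  successors s = concatMap (results s) rules
  predecessors t = concatMap (causes t) rules

  ⟶-resp : ∀ {s s′ t t′} → s ≈ s′ → t ≈ t′ → s ⟶ t → s′ ⟶ t′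
  ⟶-resp e f = Any.map λ {r} fires →
    let i , e′ , f′ , _ = unfire r fires
    in fire r i (≈-trans (≈-sym e) e′) (≈-trans (≈-sym f) f′)

  successors-sound : ∀ {s t} → t ∈ successors s → s ⟶ t
  successors-sound {s} t∈ = Any.map (λ {r} → sound r) (Any.concatMap⁻ (results s) t∈)
    where
    sound : ∀ r {t} → t ∈ results s r → Fires r s t
    sound r t∈ with ∈-map⁻ (post r) t∈
    ... | i , i∈ , refl = fire r i
      (proj₂ (∈-filter⁻ (λ i → s ≈? pre r i) {xs = instances (weight s)} i∈)) ≈-refl

  successors-complete : ∀ {s t} → s ⟶ t → Any (t ≈_) (successors s)
  successors-complete {s} {t} s⟶t = Any.concatMap⁺ (results s) (Any.map (λ {r} → complete r) s⟶t)
    where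
    complete : ∀ r → Fires r s t → Any (t ≈_) (results s r)
    complete r fires with unfire r fires
    ... | i , e , f , le , le′ =
      ∈.lose (∈-map⁺ (post r) (∈-filter⁺ (λ i → s ≈? pre r i) (∈-instances le le′) e)) f

  predecessors-sound : ∀ {t b} → b ∈ predecessors t → ∃ λ t′ → b ⟶ t′ × t ≼ t′
  predecessors-sound {t} b∈ = sound (∈.find (Any.concatMap⁻ (causes t) b∈))
    where
    sound : ∀ {b} → (∃ λ r → r ∈ rules × b ∈ causes t r) → ∃ λ t′ → b ⟶ t′ × t ≼ t′
    sound (r , r∈ , b∈) with ∈-map⁻ (pre r) b∈
    ... | i , i∈ , refl = post r i , ∈.lose r∈ (fire r i ≈-refl ≈-refl) ,
      proj₂ (∈-filter⁻ (λ i → t ≼? post r i) {xs = instances _} i∈)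

  predecessors-complete : ∀ {u t t′} → u ⟶ t′ → t ≼ t′ → Any (_≼ u) (predecessors t)
  predecessors-complete {u} {t} u⟶t′ t≼t′ =
    Any.concatMap⁺ (causes t) (Any.map (λ {r} → complete r) u⟶t′)
    where
    complete : ∀ r → Fires r u _ → Any (_≼ u) (causes t r)
    complete r fires with unfire r fires
    ... | i , e , f , _ with small-instance r (≼-trans t≼t′ (≼-reflexive f))
    ... | j , j≤i , t≼ , le , le′ =
      ∈.lose (∈-map⁺ (pre r) (∈-filter⁺ (λ i → t ≼? post r i) (∈-instances le le′) t≼))
             (≼-trans (pre-mono r j≤i) (≼-reflexive (≈-sym e)))

  -- The same rule fires from `u` at the lifted instance; monotonicity of `post` gives the order,
  -- and `weight-reflect` the strictness.
  simulate : ∀ {s t u} → s ⟶ t → s ≼ u →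
             ∃ λ v → u ⟶ v × t ≼ v × (weight v ≤ weight t → weight u ≤ weight s)
  simulate {s} {t} {u} s⟶t s≼u = run (∈.find s⟶t)
    where
    run : (∃ λ r → r ∈ rules × Fires r s t) →
          ∃ λ v → u ⟶ v × t ≼ v × (weight v ≤ weight t → weight u ≤ weight s)
    run (r , r∈ , fires) with unfire r fires
    ... | i , e , f , _ with lift r (≼-trans (≼-reflexive (≈-sym e)) s≼u)
    ... | j , i≤j , g = post r j , ∈.lose r∈ (fire r j g ≈-refl) ,
      ≼-trans (≼-reflexive f) (post-mono r i≤j) ,
      λ le → subst₂ _≤_ (sym (weight-≈ g)) (sym (weight-≈ e))
        (weight-reflect r i≤j (subst (weight (post r j) ≤_) (weight-≈ f) le))

  wellStructured : WellStructured (configs #simple #complex #colours)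
  wellStructured = record
    { _⟶_ = _⟶_
    ; ⟶-resp = ⟶-resp
    ; successors = successors
    ; successors-sound = successors-sound
    ; successors-complete = successors-complete
    ; predecessors = predecessors
    ; predecessors-sound = predecessors-sound
    ; predecessors-complete = predecessors-complete
    ; simulate = simulate
    }

  open Decision (configs #simple #complex #colours) wellStructured public

  coverable? : ∀ s₀ s-cov → Dec (Coverable s₀ s-cov)
  coverable? s₀ s-cov = map′
    (λ (t , path , c) → t , (t , path , ≈-refl) , ≼⇒≤ᶜ c)
    (λ (t , (t′ , path , t′≈t) , c) → t′ , path , ≼-trans (≤ᶜ⇒≼ c) (≼-reflexive (≈-sym t′≈t)))
    (covers? s-cov s₀)

theorem2 :
    ((N : NNCT) (s₀ s-cov : NNCT.Conf N) → Dec (NNCT.Coverable N s₀ s-cov))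
    × ((N : NNCT) (s₀ : NNCT.Conf N) → Dec (NNCT.HasInfinitePath N s₀))
    × ((N : NNCT) (s₀ : NNCT.Conf N) → Dec (NNCT.FinitelyReachable N s₀))
theorem2 = Net.coverable? , Net.infinitePath? , Net.bounded?
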